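{- For every integer $m \geq 3$, let $\Delta_{2m-1}$ be the simplicial polytope dual (polar) to the $2 \times 2m$ transportation polytope $P(\mathbf{a},\mathbf{b})$ with margins $\mathbf{a} = (2m-1,2m+1) \in \mathbb{R}^2$ and $\mathbf{b} = (2,2,\ldots,2) \in \mathbb{R}^{2m}$. Then $\Delta_{2m-1}$ is not weakly vertex-decomposable.
   Context: Simplicial complexes. A simplicial complex $\Delta$ on a (finite) vertex set $V$ is a collection of subsets of $V$, called faces, such that if $F \in \Delta$ and $G \subseteq F$ then $G \in \Delta$. The dimension of a face $F$ is $|F|-1$, and $\dim(\Delta)$ is the maximum dimension of a face of $\Delta$. A facet of $\Delta$ is a face that is maximal under inclusion, and $\Delta$ is pure if all its facets have the same dimension. For a face $\tau \in \Delta$, the antistar (deletion) is $\Delta - \tau = \{G \in \Delta : \tau \nsubseteq G\}$. Weak $k$-decomposability. Let $\Delta$ be a $(d-1)$-dimensional simplicial complex and let $0 \leq k \leq d-1$. Recursively, $\Delta$ is weakly $k$-decomposable if $\Delta$ is pure and either (1) $\Delta$ is a $(d-1)$-simplex (i.e. the complex of all subsets of a $d$-element set), or (2) there exists a face $\tau \in \Delta$ with $\dim(\tau) \leq k$ such that $\Delta - \tau$ is $(d-1)$-dimensional and weakly $k$-decomposable. Weakly vertex-decomposable means weakly $0$-decomposable. Transportation polytopes. For $\mathbf{a} = (a_1,\ldots,a_p) \in \mathbb{R}^p$ and $\mathbf{b} = (b_1,\ldots,b_n) \in \mathbb{R}^n$ (the margins), the $p \times n$ transportation polytope $P(\mathbf{a},\mathbf{b})$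 is the set of all real $p \times n$ matrices $X = (x_{i,j})$ with nonnegative entries such that $\sum_{i=1}^p x_{i,j} = b_j$ for all $1 \leq j \leq n$ and $\sum_{j=1}^n x_{i,j} = a_i$ for all $1 \leq i \leq p$. Polar. The polar (dual) of a simple polytope $P$ is taken within its affine hull and is a simplicial polytope; a simplicial polytope is identified with its boundary complex when speaking of weak vertex-decomposability. Combinatorially, the boundary complex of the polar of a simple polytope $P$ is the simplicial complex whose vertices are the facets of $P$ and whose faces are the sets of facets of $P$ that have a common point (the empty set being a face); its facets correspond to the vertices of $P$. -}

module Defs where

open import Level using (0ℓ)
open import Algebra.Bundles.Raw using (RawMonoid)
open import Data.Nat.Base as ℕ using (ℕ; _∸_)
import Data.Nat.Properties as ℕₚ
open import Data.Integer.Base as ℤ using (ℤ)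
open import Data.Rational.Base as ℚ using (ℚ; 0ℚ; 1ℚ; ½)
import Data.Rational.Properties as ℚₚ
open import Data.Rational.Solver using (module +-*-Solver)
open import Data.Fin.Base using (Fin; zero; suc)
import Data.Fin.Subset as Sub
open Sub using (Subset)
import Data.Fin.Subset.Properties as Subₚ
open import Data.Product.Base using (Σ-syntax; ∃-syntax; _×_; _,_)
open import Function.Bundles using (_⇔_)
open import Relation.Nullary using (¬_)
open import Relation.Unary using (Pred; _∈_; _⊆_; _≐_; _∩_)
open import Relation.Binary.PropositionalEquality
  using (_≡_; refl; sym; cong; subst)

------------------------------------------------------------------------
-- Real numbers: Cauchy sequences of rationals.  The setoid equality _≈_
-- plays the role of equality of real numbers.

Eventually : Pred ℕ 0ℓ → Set
Eventually Q = ∃[ N ] (∀ n → N ℕ.≤ n → Q n)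

IsCauchy : (ℕ → ℚ) → Set
IsCauchy s = ∀ ε → 0ℚ ℚ.< ε →
  ∃[ N ] (∀ m n → N ℕ.≤ m → N ℕ.≤ n → ℚ.∣ s m ℚ.- s n ∣ ℚ.< ε)

record ℝ : Set where
  constructor mkℝ
  field
    seq    : ℕ → ℚ
    cauchy : IsCauchy seq
open ℝ public

infix 4 _≈_ _≤_

_≈_ : ℝ → ℝ → Set
x ≈ y = ∀ ε → 0ℚ ℚ.< ε → Eventually λ n → ℚ.∣ seq x n ℚ.- seq y n ∣ ℚ.< ε

_≤_ : ℝ → ℝ → Set
x ≤ y = ∀ ε → 0ℚ ℚ.< ε → Eventually λ n → seq x n ℚ.< seq y n ℚ.+ ε

fromℚ : ℚ → ℝ
fromℚ q = mkℝ (λ _ → q) λ ε 0<ε →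
  0 , λ _ _ _ _ → subst (λ z → ℚ.∣ z ∣ ℚ.< ε) (sym (ℚₚ.+-inverseʳ q)) 0<ε

fromℕ : ℕ → ℝ
fromℕ k = fromℚ (ℤ.+ k ℚ./ 1)

open +-*-Solver using (solve; _:+_; _:*_; _:-_; _:=_; con)

half-pos : ∀ {ε} → 0ℚ ℚ.< ε → 0ℚ ℚ.< ½ ℚ.* ε
half-pos {ε} 0<ε = subst (ℚ._< ½ ℚ.* ε) (ℚₚ.*-zeroʳ ½) (ℚₚ.*-monoʳ-<-pos ½ 0<ε)

half+half : ∀ ε → ½ ℚ.* ε ℚ.+ ½ ℚ.* ε ≡ ε
half+half = solve 1 (λ e → con ½ :* e :+ con ½ :* e := e) refl

-- The Cauchy proofs are abstract only so that normalising a statement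
-- about reals does not unfold them.
abstract
  +-cauchy : ∀ {s t} → IsCauchy s → IsCauchy t → IsCauchy (λ n → s n ℚ.+ t n)
  +-cauchy {s} {t} cs ct ε 0<ε with cs _ (half-pos 0<ε) | ct _ (half-pos 0<ε)
  ... | M , hs | N , ht = M ℕ.⊔ N , λ m n p q →
    let open ℚₚ.≤-Reasoning
        a = s m ℚ.- s n
        b = t m ℚ.- t n
    in begin-strict
      ℚ.∣ s m ℚ.+ t m ℚ.- (s n ℚ.+ t n) ∣
        ≡⟨ cong ℚ.∣_∣ (solve 4 (λ x y u v →
             x :+ u :- (y :+ v) := x :- y :+ (u :- v)) refl (s m) (s n) (t m) (t n)) ⟩
      ℚ.∣ a ℚ.+ b ∣
        ≤⟨ ℚₚ.∣p+q∣≤∣p∣+∣q∣ a b ⟩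
      ℚ.∣ a ∣ ℚ.+ ℚ.∣ b ∣
        <⟨ ℚₚ.+-mono-<
             (hs m n (ℕₚ.≤-trans (ℕₚ.m≤m⊔n M N) p) (ℕₚ.≤-trans (ℕₚ.m≤m⊔n M N) q))
             (ht m n (ℕₚ.≤-trans (ℕₚ.m≤n⊔m M N) p) (ℕₚ.≤-trans (ℕₚ.m≤n⊔m M N) q)) ⟩
      ½ ℚ.* ε ℚ.+ ½ ℚ.* ε
        ≡⟨ half+half ε ⟩
      ε ∎

eventually-bounded : ∀ {s} → IsCauchy s →
  ∃[ K ] (0ℚ ℚ.< K × Eventually λ n → ℚ.∣ s n ∣ ℚ.≤ K)
eventually-bounded {s} cs with cs 1ℚ (ℚₚ.positive⁻¹ 1ℚ)
... | N , h = 1ℚ ℚ.+ ℚ.∣ s N ∣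
            , ℚₚ.+-mono-<-≤ (ℚₚ.positive⁻¹ 1ℚ) (ℚₚ.0≤∣p∣ (s N))
            , N , λ n p →
  let open ℚₚ.≤-Reasoning in begin
    ℚ.∣ s n ∣
      ≡⟨ cong ℚ.∣_∣ (solve 2 (λ x y → x := x :- y :+ y) refl (s n) (s N)) ⟩
    ℚ.∣ s n ℚ.- s N ℚ.+ s N ∣
      ≤⟨ ℚₚ.∣p+q∣≤∣p∣+∣q∣ (s n ℚ.- s N) (s N) ⟩
    ℚ.∣ s n ℚ.- s N ∣ ℚ.+ ℚ.∣ s N ∣
      ≤⟨ ℚₚ.+-monoˡ-≤ ℚ.∣ s N ∣ (ℚₚ.<⇒≤ (h n N p ℕₚ.≤-refl)) ⟩
    1ℚ ℚ.+ ℚ.∣ s N ∣ ∎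

small-product : ∀ B ε → .{{ℚ.Positive B}} → 0ℚ ℚ.< ε →
  ∃[ δ ] (0ℚ ℚ.< δ × (∀ x y → ℚ.∣ x ∣ ℚ.≤ B → ℚ.∣ y ∣ ℚ.< δ → ℚ.∣ x ℚ.* y ∣ ℚ.< ε))
small-product B ε 0<ε = δ , 0<δ , λ x y p q → begin-strict
    ℚ.∣ x ℚ.* y ∣         ≡⟨ ℚₚ.∣p*q∣≡∣p∣*∣q∣ x y ⟩
    ℚ.∣ x ∣ ℚ.* ℚ.∣ y ∣   ≤⟨ ℚₚ.*-monoʳ-≤-nonNeg ℚ.∣ y ∣ {{ℚₚ.∣-∣-nonNeg y}} p ⟩
    B ℚ.* ℚ.∣ y ∣         <⟨ ℚₚ.*-monoʳ-<-pos B q ⟩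
    B ℚ.* δ               ≡⟨ sym (ℚₚ.*-assoc B B⁻¹ ε) ⟩
    B ℚ.* B⁻¹ ℚ.* ε       ≡⟨ cong (ℚ._* ε) (ℚₚ.*-inverseʳ B {{ℚₚ.pos⇒nonZero B}}) ⟩
    1ℚ ℚ.* ε              ≡⟨ ℚₚ.*-identityˡ ε ⟩
    ε                     ∎
  where
  open ℚₚ.≤-Reasoning
  B⁻¹ = (ℚ.1/ B) {{ℚₚ.pos⇒nonZero B}}
  δ = B⁻¹ ℚ.* ε
  0<δ : 0ℚ ℚ.< δ
  0<δ = subst (ℚ._< δ) (ℚₚ.*-zeroʳ B⁻¹)
          (ℚₚ.*-monoʳ-<-pos B⁻¹ {{ℚₚ.1/pos⇒pos B}} 0<ε)

product-difference : ∀ x y u v →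
  x ℚ.* u ℚ.- y ℚ.* v ≡ x ℚ.* (u ℚ.- v) ℚ.+ v ℚ.* (x ℚ.- y)
product-difference = solve 4 (λ x y u v →
  x :* u :- y :* v := x :* (u :- v) :+ v :* (x :- y)) refl

product-estimate : ∀ x y u v ε →
  ℚ.∣ x ℚ.* (u ℚ.- v) ∣ ℚ.< ½ ℚ.* ε → ℚ.∣ v ℚ.* (x ℚ.- y) ∣ ℚ.< ½ ℚ.* ε →
  ℚ.∣ x ℚ.* u ℚ.- y ℚ.* v ∣ ℚ.< ε
product-estimate x y u v ε p q = begin-strict
    ℚ.∣ x ℚ.* u ℚ.- y ℚ.* v ∣
      ≡⟨ cong ℚ.∣_∣ (product-difference x y u v) ⟩
    ℚ.∣ x ℚ.* (u ℚ.- v) ℚ.+ v ℚ.* (x ℚ.- y) ∣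
      ≤⟨ ℚₚ.∣p+q∣≤∣p∣+∣q∣ (x ℚ.* (u ℚ.- v)) (v ℚ.* (x ℚ.- y)) ⟩
    ℚ.∣ x ℚ.* (u ℚ.- v) ∣ ℚ.+ ℚ.∣ v ℚ.* (x ℚ.- y) ∣
      <⟨ ℚₚ.+-mono-< p q ⟩
    ½ ℚ.* ε ℚ.+ ½ ℚ.* ε
      ≡⟨ half+half ε ⟩
    ε ∎
  where open ℚₚ.≤-Reasoning

abstract
  *-cauchy : ∀ {s t} → IsCauchy s → IsCauchy t → IsCauchy (λ n → s n ℚ.* t n)
  *-cauchy {s} {t} cs ct ε 0<ε =
    let K , 0<K , M₁ , bs   = eventually-bounded {s} cs
        L , 0<L , M₂ , bt   = eventually-bounded {t} ct
        δ₁ , 0<δ₁ , small₁ = small-product K (½ ℚ.* ε) {{ℚ.positive 0<K}} (half-pos 0<ε)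
        δ₂ , 0<δ₂ , small₂ = small-product L (½ ℚ.* ε) {{ℚ.positive 0<L}} (half-pos 0<ε)
        N₁ , ht             = ct δ₁ 0<δ₁
        N₂ , hs             = cs δ₂ 0<δ₂
        M≤  = ℕₚ.m≤m⊔n (M₁ ℕ.⊔ M₂) (N₁ ℕ.⊔ N₂)
        N≤  = ℕₚ.m≤n⊔m (M₁ ℕ.⊔ M₂) (N₁ ℕ.⊔ N₂)
        M₁≤ = ℕₚ.≤-trans (ℕₚ.m≤m⊔n M₁ M₂) M≤
        M₂≤ = ℕₚ.≤-trans (ℕₚ.m≤n⊔m M₁ M₂) M≤
        N₁≤ = ℕₚ.≤-trans (ℕₚ.m≤m⊔n N₁ N₂) N≤
        N₂≤ = ℕₚ.≤-trans (ℕₚ.m≤n⊔m N₁ N₂) N≤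
    in (M₁ ℕ.⊔ M₂) ℕ.⊔ (N₁ ℕ.⊔ N₂) , λ m n p q →
      product-estimate (s m) (s n) (t m) (t n) ε
        (small₁ (s m) (t m ℚ.- t n) (bs m (ℕₚ.≤-trans M₁≤ p))
          (ht m n (ℕₚ.≤-trans N₁≤ p) (ℕₚ.≤-trans N₁≤ q)))
        (small₂ (t n) (s m ℚ.- s n) (bt n (ℕₚ.≤-trans M₂≤ q))
          (hs m n (ℕₚ.≤-trans N₂≤ p) (ℕₚ.≤-trans N₂≤ q)))

infixl 6 _+_
infixl 7 _*_

_+_ : ℝ → ℝ → ℝ
x + y = mkℝ (λ n → seq x n ℚ.+ seq y n) (+-cauchy {seq x} {seq y} (cauchy x) (cauchy y))

_*_ : ℝ → ℝ → ℝ
x * y = mkℝ (λ n → seq x n ℚ.* seq y n) (*-cauchy {seq x} {seq y} (cauchy x) (cauchy y))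

0ℝ : ℝ
0ℝ = fromℕ 0

+-0-rawMonoid : RawMonoid 0ℓ 0ℓ
+-0-rawMonoid = record { Carrier = ℝ ; _≈_ = _≈_ ; _∙_ = _+_ ; ε = 0ℝ }

open import Algebra.Definitions.RawMonoid +-0-rawMonoid public using (sum)

------------------------------------------------------------------------
-- Subsets of matrix space, their faces and facets

Matrix : ℕ → ℕ → Set
Matrix p n = Fin p → Fin n → ℝ

Region : ℕ → ℕ → Set₁
Region p n = Pred (Matrix p n) 0ℓ

⟨_,_⟩ : ∀ {p n} → Matrix p n → Matrix p n → ℝ
⟨ C , X ⟩ = sum λ i → sum λ j → C i j * X i j

-- A face of P is cut out by a linear inequality valid on P.  C = 0 is
-- allowed, so that P and ∅ are (improper resp. empty) faces.
IsFace : ∀ {p n} → Region p n → Region p n → Set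
IsFace {p} {n} P F =
  Σ[ C ∈ Matrix p n ] Σ[ δ ∈ ℝ ]
    (∀ X → X ∈ P → ⟨ C , X ⟩ ≤ δ) × F ≐ (P ∩ λ X → ⟨ C , X ⟩ ≈ δ)

IsProperFace : ∀ {p n} → Region p n → Region p n → Set
IsProperFace P F = IsFace P F × ¬ (P ⊆ F)

IsFacet : ∀ {p n} → Region p n → Region p n → Set₁
IsFacet P F = IsProperFace P F × (∀ G → IsProperFace P G → F ⊆ G → G ⊆ F)

-- A labelling of the facets of P by Fin N, each facet occurring exactly
-- once up to equality of sets of points.  Completeness only asks that no
-- facet is missed: a constructive search for the label of an arbitrary
-- facet would require deciding equality of real numbers.
record FacetEnumeration {p n} (P : Region p n) (N : ℕ) : Set₁ where
  field
    facet    : Fin N → Region p n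
    isFacet  : ∀ k → IsFacet P (facet k)
    distinct : ∀ k l → facet k ≐ facet l → k ≡ l
    complete : ∀ F → IsFacet P F → ¬ (∀ k → ¬ (F ≐ facet k))

TransportationPolytope : ∀ {p n} → (Fin p → ℝ) → (Fin n → ℝ) → Region p n
TransportationPolytope a b X =
    (∀ i j → 0ℝ ≤ X i j)
  × (∀ j → sum (λ i → X i j) ≈ b j)
  × (∀ i → sum (λ j → X i j) ≈ a i)

------------------------------------------------------------------------
-- Simplicial complexes

record SimplicialComplex (N : ℕ) : Set₁ where
  field
    Face       : Pred (Subset N) 0ℓ
    downClosed : ∀ {F G} → Face F → G Sub.⊆ F → Face G
open SimplicialComplex public

dim : ∀ {N} → Subset N → ℤ
dim F = ℤ.+ Sub.∣ F ∣ ℤ.- ℤ.1ℤ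

HasDimension : ∀ {N} → SimplicialComplex N → ℤ → Set
HasDimension Δ e = (∃[ F ] (Face Δ F × dim F ≡ e)) × (∀ F → Face Δ F → dim F ℤ.≤ e)

MaximalFace : ∀ {N} → SimplicialComplex N → Pred (Subset N) 0ℓ
MaximalFace Δ F = Face Δ F × (∀ G → Face Δ G → F Sub.⊆ G → F ≡ G)

Pure : ∀ {N} → SimplicialComplex N → Set
Pure Δ = ∀ F G → MaximalFace Δ F → MaximalFace Δ G → dim F ≡ dim G

IsSimplex : ∀ {N} → SimplicialComplex N → Set
IsSimplex Δ = ∃[ S ] (∀ G → Face Δ G ⇔ G Sub.⊆ S)

infixl 6 _−_

_−_ : ∀ {N} → SimplicialComplex N → Subset N → SimplicialComplex N
Δ − τ = record
  { Face       = λ G → Face Δ G × ¬ (τ Sub.⊆ G)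
  ; downClosed = λ (f , τ⊈F) G⊆F →
      downClosed Δ f G⊆F , λ τ⊆G → τ⊈F (Subₚ.⊆-trans τ⊆G G⊆F)
  }

data WeaklyDecomposable {N : ℕ} (k : ℕ) (Δ : SimplicialComplex N) : Set₁ where
  simplex : Pure Δ → IsSimplex Δ → WeaklyDecomposable k Δ
  shed    : Pure Δ → ∀ e → HasDimension Δ e →
            ∀ τ → Face Δ τ → dim τ ℤ.≤ ℤ.+ k →
            HasDimension (Δ − τ) e → WeaklyDecomposable k (Δ − τ) →
            WeaklyDecomposable k Δ

WeaklyVertexDecomposable : ∀ {N} → SimplicialComplex N → Set₁
WeaklyVertexDecomposable = WeaklyDecomposable 0

-- For a simple polytope P this is the boundary complex of its polar: the
-- vertices are (labels of) facets of P, and a set of facets is a face when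
-- they have a common point in P.
polarBoundary : ∀ {p n N} {P : Region p n} → FacetEnumeration P N → SimplicialComplex N
polarBoundary {P = P} E = record
  { Face       = λ S → ∃[ X ] (X ∈ P × (∀ {k} → k Sub.∈ S → X ∈ facet k))
  ; downClosed = λ (X , X∈P , h) G⊆F → X , X∈P , λ k∈G → h (G⊆F k∈G)
  }
  where open FacetEnumeration E

------------------------------------------------------------------------

rowMargins : ℕ → Fin 2 → ℝ
rowMargins m zero    = fromℕ (2 ℕ.* m ∸ 1)
rowMargins m (suc _) = fromℕ (2 ℕ.* m ℕ.+ 1)

columnMargins : ∀ {n} → Fin n → ℝ
columnMargins _ = fromℕ 2

{-# OPTIONS --safe #-}

-- A point of the polytope is determined by its first row x ∈ [0,2]^2m with
-- Σ x = 2m-1, and its facets are the 4m sets where an entry of the matrix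
-- vanishes: a proper face in no such set would contain, by averaging, a point
-- with positive entries, from which one can step away from any other point, so
-- that it would be everything.  A vertex has one column (1,1); its other columns
-- are (2,0) or (0,2), with m-1 or m entries 2 in the two rows.
--
-- Shedding deletes these facet labels one at a time.  While each row has lost at most
-- one label, some column keeps both of its labels, so the complex is not a
-- simplex.  When a row loses a second one, choosing the other zeros so that these
-- two columns remain undetermined gives a maximal face with one vertex too few,
-- which contradicts purity; m ≥ 3 leaves enough columns for this choice.

module Submission where

open import Defs
open import Data.Bool.Base using (true; false; if_then_else_)
open import Data.Empty using (⊥; ⊥-elim)
open import Data.Fin.Base as Fin using (Fin; zero; suc)
import Data.Fin.Properties as Finₚ
open import Data.Fin.Subset as Sub using (Subset; inside; outside; ⁅_⁆; ∁; _∪_)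
import Data.Fin.Subset.Properties as Subₚ
open import Data.Integer.Base as ℤ using (ℤ)
import Data.Integer.Properties as ℤₚ
open import Data.Maybe.Base using (Maybe; just; nothing; fromMaybe)
open import Data.Maybe.Properties using (just-injective)
open import Data.Nat.Base as ℕ using (ℕ; zero; suc; _∸_)
import Data.Nat.Properties as ℕₚ
open import Data.Product.Base using (Σ-syntax; ∃-syntax; _×_; _,_; proj₁; proj₂)
open import Data.Rational.Base as ℚ using (ℚ; 0ℚ; 1ℚ; ½)
import Data.Rational.Properties as ℚₚ
open import Data.Rational.Solver using (module +-*-Solver)
import Data.Rational.Unnormalised.Base as ℚᵘ
import Data.Rational.Unnormalised.Properties as ℚᵘₚ
open import Data.Sum.Base using (_⊎_; inj₁; inj₂)
open import Data.Vec.Base using (_∷_; []; lookup; tabulate)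
import Data.Vec.Properties as Vecₚ
open import Effect.Monad using (RawMonad)
open import Function.Base using (_∘_; case_of_; id)
open import Function.Bundles using (Equivalence)
open import Relation.Binary.PropositionalEquality
open import Relation.Nullary using (¬_; yes; no; does; contradiction; ¬?)
open import Relation.Nullary.Decidable
  using (dec-true; dec-false; _×-dec_; _⊎-dec_; decidable-stable)
open import Relation.Nullary.Negation using (¬¬-Monad)
open import Relation.Unary using (_∈_; _⊆_; _≐_; _∩_; Decidable)
open +-*-Solver using (solve; _:+_; _:*_; _:-_; :-_; _:=_; con)
open import Algebra.Properties.Semiring.Sum ℕₚ.+-*-semiring as ℕ-Sum
  using (∑-distrib-+; *-distribˡ-sum; sum-cong-≗)

-- Nonnegative limits and the order of the reals.

Seq : Set
Seq = ℕ → ℚ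

eventually-× : ∀ {P Q : ℕ → Set} → Eventually P → Eventually Q → Eventually λ n → P n × Q n
eventually-× (M , f) (N , g) = M ℕ.⊔ N , λ n p →
  f n (ℕₚ.≤-trans (ℕₚ.m≤m⊔n M N) p) , g n (ℕₚ.≤-trans (ℕₚ.m≤n⊔m M N) p)

eventually-map : ∀ {P Q : ℕ → Set} → (∀ {n} → P n → Q n) → Eventually P → Eventually Q
eventually-map f (N , g) = N , λ n p → f (g n p)

0<q-p : ∀ {p q} → p ℚ.< q → 0ℚ ℚ.< q ℚ.- p
0<q-p {p} {q} h = subst (ℚ._< q ℚ.- p) (ℚₚ.+-inverseʳ p) (ℚₚ.+-monoˡ-< (ℚ.- p) h)

0<q-p⁻¹ : ∀ {p q} → 0ℚ ℚ.< q ℚ.- p → p ℚ.< q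
0<q-p⁻¹ {p} {q} h = subst₂ ℚ._<_ (ℚₚ.+-identityˡ p)
  (solve 2 (λ p q → q :- p :+ p := q) refl p q) (ℚₚ.+-monoˡ-< p h)

p≤∣p∣ : ∀ p → p ℚ.≤ ℚ.∣ p ∣
p≤∣p∣ p with ℚₚ.≤-total 0ℚ p
... | inj₁ h = ℚₚ.≤-reflexive (sym (ℚₚ.0≤p⇒∣p∣≡p h))
... | inj₂ h = ℚₚ.≤-trans h (ℚₚ.0≤∣p∣ p)

∣p∣<⇒ : ∀ {p ε} → ℚ.∣ p ∣ ℚ.< ε → p ℚ.< ε × ℚ.- p ℚ.< ε
∣p∣<⇒ {p} h = ℚₚ.≤-<-trans (p≤∣p∣ p) h
            , ℚₚ.≤-<-trans (p≤∣p∣ (ℚ.- p)) (subst (ℚ._< _) (sym (ℚₚ.∣-p∣≡∣p∣ p)) h)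

⇒∣p∣< : ∀ {p ε} → p ℚ.< ε → ℚ.- p ℚ.< ε → ℚ.∣ p ∣ ℚ.< ε
⇒∣p∣< {p} h k with ℚₚ.∣p∣≡p∨∣p∣≡-p p
... | inj₁ e = subst (ℚ._< _) (sym e) h
... | inj₂ e = subst (ℚ._< _) (sym e) k

-- Nonnegative limit inferior. No Cauchy condition is asked, so differences of reals can be
-- rearranged termwise as rationals; being a record, it lets `s` be inferred.
record Lim≥0 (s : Seq) : Set where
  constructor lim≥0
  field eventually : ∀ ε → 0ℚ ℚ.< ε → Eventually λ n → 0ℚ ℚ.< s n ℚ.+ ε
open Lim≥0 public

Lim≥0-resp : ∀ {s t} → (∀ n → s n ≡ t n) → Lim≥0 s → Lim≥0 t
Lim≥0-resp e h .eventually ε 0<ε =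
  eventually-map (λ {n} → subst (λ z → 0ℚ ℚ.< z ℚ.+ ε) (e n)) (eventually h ε 0<ε)

Lim≥0-+ : ∀ {s t} → Lim≥0 s → Lim≥0 t → Lim≥0 (λ n → s n ℚ.+ t n)
Lim≥0-+ {s} {t} hs ht .eventually ε 0<ε =
  eventually-map (λ {n} (a , b) → subst (0ℚ ℚ.<_)
      (trans (solve 3 (λ x y z → x :+ z :+ (y :+ z) := x :+ y :+ (z :+ z)) refl (s n) (t n) (½ ℚ.* ε))
             (cong (s n ℚ.+ t n ℚ.+_) (half+half ε)))
      (ℚₚ.+-mono-< a b))
    (eventually-× (eventually hs _ (half-pos 0<ε)) (eventually ht _ (half-pos 0<ε)))

*-positive : ∀ {p q} → 0ℚ ℚ.< p → 0ℚ ℚ.< q → 0ℚ ℚ.< p ℚ.* q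
*-positive {p} {q} 0<p 0<q = subst (ℚ._< p ℚ.* q) (ℚₚ.*-zeroʳ p)
  (ℚₚ.*-monoʳ-<-pos p {{ℚ.positive 0<p}} 0<q)

positive-inverse : ∀ {p} → 0ℚ ℚ.< p → ∃[ r ] (0ℚ ℚ.< r × r ℚ.* p ≡ 1ℚ)
positive-inverse {p} 0<p = r , ℚₚ.positive⁻¹ r {{ℚₚ.1/pos⇒pos p}} , ℚₚ.*-inverseˡ p
  where
  instance
    pos : ℚ.Positive p
    pos = ℚ.positive 0<p
    nz : ℚ.NonZero p
    nz = ℚₚ.pos⇒nonZero p
  r = ℚ.1/ p

Lim≥0-*-pos : ∀ {s p} → 0ℚ ℚ.< p → Lim≥0 s → Lim≥0 (λ n → p ℚ.* s n)
Lim≥0-*-pos {s} {p} 0<p h .eventually ε 0<ε with positive-inverse 0<p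
... | r , 0<r , rp≡1 = eventually-map (λ {n} a → subst (0ℚ ℚ.<_)
    (trans (solve 4 (λ p s r e → p :* (s :+ r :* e) := p :* s :+ r :* p :* e) refl p (s n) r ε)
      (cong (p ℚ.* s n ℚ.+_) (trans (cong (ℚ._* ε) rp≡1) (ℚₚ.*-identityˡ ε))))
    (*-positive 0<p a))
  (eventually h _ (*-positive 0<r 0<ε))

Lim≥0-const : ∀ {q} → 0ℚ ℚ.≤ q → Lim≥0 (λ _ → q)
Lim≥0-const {q} 0≤q .eventually ε 0<ε = 0 , λ _ _ → ℚₚ.+-mono-≤-< 0≤q 0<ε

Lim≥0-const⁻¹ : ∀ {q} → Lim≥0 (λ _ → q) → 0ℚ ℚ.≤ q
Lim≥0-const⁻¹ {q} h with 0ℚ ℚₚ.≤? q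
... | yes 0≤q = 0≤q
... | no  0≰q with eventually h (ℚ.- q) (ℚₚ.neg-antimono-< (ℚₚ.≰⇒> 0≰q))
... | N , f with () ← ℚₚ.<-irrefl (sym (ℚₚ.+-inverseʳ q)) (f N ℕₚ.≤-refl)

≤⇒Lim≥0 : ∀ x y → x ≤ y → Lim≥0 (λ n → seq y n ℚ.- seq x n)
≤⇒Lim≥0 x y h .eventually ε 0<ε = eventually-map (λ {n} a → subst (0ℚ ℚ.<_)
  (solve 3 (λ y e x → y :+ e :- x := y :- x :+ e) refl (seq y n) ε (seq x n)) (0<q-p a)) (h ε 0<ε)

Lim≥0⇒≤ : ∀ x y → Lim≥0 (λ n → seq y n ℚ.- seq x n) → x ≤ y
Lim≥0⇒≤ x y h ε 0<ε = eventually-map (λ {n} a → 0<q-p⁻¹ (subst (0ℚ ℚ.<_)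
  (solve 3 (λ y e x → y :- x :+ e := y :+ e :- x) refl (seq y n) ε (seq x n)) a)) (eventually h ε 0<ε)

≈⇒≤ : ∀ x y → x ≈ y → x ≤ y
≈⇒≤ x y h ε 0<ε = eventually-map (λ {n} a → 0<q-p⁻¹ (subst (0ℚ ℚ.<_)
   (solve 3 (λ y e x → e :- (x :- y) := y :+ e :- x) refl (seq y n) ε (seq x n)) (0<q-p (proj₁ (∣p∣<⇒ a)))))
  (h ε 0<ε)

≈-sym : ∀ x y → x ≈ y → y ≈ x
≈-sym x y h ε 0<ε = eventually-map (λ {n} → subst (ℚ._< ε)
  (trans (sym (ℚₚ.∣-p∣≡∣p∣ (seq x n ℚ.- seq y n)))
    (cong ℚ.∣_∣ (solve 2 (λ x y → :- (x :- y) := y :- x) refl (seq x n) (seq y n))))) (h ε 0<ε)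

≤-antisym : ∀ x y → x ≤ y → y ≤ x → x ≈ y
≤-antisym x y h k ε 0<ε = eventually-map (λ {n} (a , b) → ⇒∣p∣<
    (0<q-p⁻¹ (subst (0ℚ ℚ.<_)
      (solve 3 (λ x y e → y :+ e :- x := e :- (x :- y)) refl (seq x n) (seq y n) ε) (0<q-p a)))
    (0<q-p⁻¹ (subst (0ℚ ℚ.<_)
      (solve 3 (λ x y e → x :+ e :- y := e :- (:- (x :- y))) refl (seq x n) (seq y n) ε) (0<q-p b))))
  (eventually-× (h ε 0<ε) (k ε 0<ε))

Lim≥0-* : ∀ {s p} → 0ℚ ℚ.≤ p → Lim≥0 s → Lim≥0 (λ n → p ℚ.* s n)
Lim≥0-* {s} {p} 0≤p h with 0ℚ ℚₚ.<? p
... | yes 0<p = Lim≥0-*-pos 0<p h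
... | no  0≮p = Lim≥0-resp
  (λ n → sym (trans (cong (ℚ._* s n) (ℚₚ.≤-antisym (ℚₚ.≮⇒≥ 0≮p) 0≤p)) (ℚₚ.*-zeroˡ (s n))))
  (Lim≥0-const ℚₚ.≤-refl)

-- `α` may lie outside [0,1], as extrapolating beyond a point requires. The error `z - b` splits as
-- `α (x - b) + (1 - α) (y - b)`.
≈-affine : ∀ α x y z b →
  (∀ n → seq z n ≡ α ℚ.* seq x n ℚ.+ (1ℚ ℚ.- α) ℚ.* seq y n) →
  x ≈ b → y ≈ b → z ≈ b
≈-affine α x y z b e x≈b y≈b ε 0<ε =
  let _ , 0<δ₁ , small₁ = small-product (1+∣ α ∣) (½ ℚ.* ε) {{pos α}} (half-pos 0<ε)
      _ , 0<δ₂ , small₂ = small-product (1+∣ 1ℚ ℚ.- α ∣) (½ ℚ.* ε) {{pos (1ℚ ℚ.- α)}} (half-pos 0<ε)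
  in eventually-map (λ {n} (p , q) →
       subst₂ ℚ._<_
         (cong ℚ.∣_∣ (trans (solve 4 (λ α x y b →
             α :* (x :- b) :+ (con 1ℚ :- α) :* (y :- b) := α :* x :+ (con 1ℚ :- α) :* y :- b)
             refl α (seq x n) (seq y n) (seq b n)) (cong (ℚ._- seq b n) (sym (e n)))))
         (half+half ε)
         (ℚₚ.≤-<-trans (ℚₚ.∣p+q∣≤∣p∣+∣q∣ (α ℚ.* (seq x n ℚ.- seq b n)) _)
           (ℚₚ.+-mono-< (small₁ α _ (bound α) p) (small₂ (1ℚ ℚ.- α) _ (bound (1ℚ ℚ.- α)) q))))
     (eventually-× (x≈b _ 0<δ₁) (y≈b _ 0<δ₂))
  where
  -- Adding 1 keeps the bound positive even for a zero coefficient.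
  1+∣_∣ : ℚ → ℚ
  1+∣ p ∣ = 1ℚ ℚ.+ ℚ.∣ p ∣
  pos : ∀ p → ℚ.Positive 1+∣ p ∣
  pos p = ℚ.positive (ℚₚ.+-mono-<-≤ (ℚₚ.positive⁻¹ 1ℚ) (ℚₚ.0≤∣p∣ p))
  bound : ∀ p → ℚ.∣ p ∣ ℚ.≤ 1+∣ p ∣
  bound p = subst (ℚ._≤ 1+∣ p ∣) (ℚₚ.+-identityˡ ℚ.∣ p ∣)
              (ℚₚ.+-monoˡ-≤ ℚ.∣ p ∣ (ℚₚ.nonNegative⁻¹ 1ℚ))

-- Comparing one sufficiently late term with ¾ ε decides the alternative.
small-or-positive : ∀ x ε → 0ℚ ℚ.< ε →
  Eventually (λ n → seq x n ℚ.< ε) ⊎ Lim≥0 (λ n → seq x n ℚ.- ½ ℚ.* ε)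
small-or-positive x ε 0<ε with cauchy x (½ ℚ.* (½ ℚ.* ε)) (half-pos (half-pos 0<ε))
... | N , close with seq x N ℚₚ.<? ½ ℚ.* ε ℚ.+ ½ ℚ.* (½ ℚ.* ε)
... | yes lt = inj₁ (N , λ n p → 0<q-p⁻¹ (subst (0ℚ ℚ.<_)
        (solve 3 (λ e x y → ((con ½ :* e :+ con ½ :* (con ½ :* e)) :- y)
             :+ (con ½ :* (con ½ :* e) :- (x :- y)) := e :- x)
          refl ε (seq x n) (seq x N))
        (ℚₚ.+-mono-< (0<q-p lt) (0<q-p (proj₁ (∣p∣<⇒ (close n N p ℕₚ.≤-refl)))))))
... | no  ge = inj₂ (lim≥0 λ ε′ 0<ε′ → N , λ n p → ℚₚ.+-mono-< {0ℚ} {_} {0ℚ}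
        (subst (0ℚ ℚ.<_)
          (solve 3 (λ e x y → (y :- (con ½ :* e :+ con ½ :* (con ½ :* e)))
               :+ (con ½ :* (con ½ :* e) :- (y :- x)) := x :- con ½ :* e)
            refl ε (seq x n) (seq x N))
          (ℚₚ.+-mono-≤-< (subst (ℚ._≤ seq x N ℚ.- M) (ℚₚ.+-inverseʳ M)
              (ℚₚ.+-monoˡ-≤ (ℚ.- M) (ℚₚ.≮⇒≥ ge)))
            (0<q-p (proj₁ (∣p∣<⇒ (close N n ℕₚ.≤-refl p)))))) 0<ε′)
  where M = ½ ℚ.* ε ℚ.+ ½ ℚ.* (½ ℚ.* ε)

0≤⇒Lim≥0 : ∀ x → 0ℝ ≤ x → Lim≥0 (seq x)
0≤⇒Lim≥0 x h = Lim≥0-resp (λ n → ℚₚ.+-identityʳ (seq x n)) (≤⇒Lim≥0 0ℝ x h)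

Lim≥0⇒0≤ : ∀ x → Lim≥0 (seq x) → 0ℝ ≤ x
Lim≥0⇒0≤ x h = Lim≥0⇒≤ 0ℝ x (Lim≥0-resp (λ n → sym (ℚₚ.+-identityʳ (seq x n))) h)

-- At each `ε` the alternative `small-or-positive` must return smallness, since every positive lower
-- bound is excluded.
not-positive⇒≈0 : ∀ x → 0ℝ ≤ x → ¬ (∃[ η ] (0ℚ ℚ.< η × Lim≥0 (λ n → seq x n ℚ.- η))) → x ≈ 0ℝ
not-positive⇒≈0 x 0≤x ¬pos = ≤-antisym x 0ℝ x≤0 0≤x
  where
  x≤0 : x ≤ 0ℝ
  x≤0 ε 0<ε with small-or-positive x ε 0<ε
  ... | inj₁ h = eventually-map (λ {n} → subst (seq x n ℚ.<_) (sym (ℚₚ.+-identityˡ ε))) h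
  ... | inj₂ h = ⊥-elim (¬pos (½ ℚ.* ε , half-pos 0<ε , h))

positive⇒≉0 : ∀ x η → 0ℚ ℚ.< η → Lim≥0 (λ n → seq x n ℚ.- η) → ¬ (x ≈ 0ℝ)
positive⇒≉0 x η 0<η h x≈0 = ℚₚ.<-irrefl refl (ℚₚ.<-≤-trans 0<η
  (subst (ℚ._≤ 0ℚ) (solve 1 (λ e → :- (:- e) := e) refl η)
  (ℚₚ.neg-antimono-≤ (Lim≥0-const⁻¹ (Lim≥0-resp
    (λ n → solve 2 (λ x e → con 0ℚ :- x :+ (x :- e) := :- e) refl (seq x n) η)
    (Lim≥0-+ (≤⇒Lim≥0 x 0ℝ (≈⇒≤ x 0ℝ x≈0)) h))))))

-- For a nonnegative real, vanishing amounts to the absence of a positive lower bound, a negative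
-- statement. This discharges double negations without deciding equality of reals.
≈0-stable : ∀ x → 0ℝ ≤ x → ¬ ¬ (x ≈ 0ℝ) → x ≈ 0ℝ
≈0-stable x 0≤x ¬¬x≈0 = not-positive⇒≈0 x 0≤x λ (η , 0<η , h) → ¬¬x≈0 (positive⇒≉0 x η 0<η h)

-- Affine combinations and linear functionals on matrices.

comb : ∀ {p n} → ℚ → Matrix p n → Matrix p n → Matrix p n
comb α X Y i j = fromℚ α * X i j + fromℚ (1ℚ ℚ.- α) * Y i j

-- An equation between the terms of the representing sequences, stronger than `≈`, so that it can be
-- used for rewriting.
Affine : ∀ {p n} → (Matrix p n → ℝ) → Set
Affine L = ∀ α X Y q →
  seq (L (comb α X Y)) q ≡ α ℚ.* seq (L X) q ℚ.+ (1ℚ ℚ.- α) ℚ.* seq (L Y) q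

sum-comb : ∀ {k} α (f g h : Fin k → ℝ) q →
  (∀ i → seq (h i) q ≡ α ℚ.* seq (f i) q ℚ.+ (1ℚ ℚ.- α) ℚ.* seq (g i) q) →
  seq (sum h) q ≡ α ℚ.* seq (sum f) q ℚ.+ (1ℚ ℚ.- α) ℚ.* seq (sum g) q
sum-comb {zero}  α f g h q e = solve 1 (λ α → con 0ℚ := α :* con 0ℚ :+ (con 1ℚ :- α) :* con 0ℚ) refl α
sum-comb {suc k} α f g h q e = trans
  (cong₂ ℚ._+_ (e zero) (sum-comb α (f ∘ suc) (g ∘ suc) (h ∘ suc) q (e ∘ suc)))
  (solve 5 (λ α a b c d →
      α :* a :+ (con 1ℚ :- α) :* b :+ (α :* c :+ (con 1ℚ :- α) :* d)
      := α :* (a :+ c) :+ (con 1ℚ :- α) :* (b :+ d))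
    refl α (seq (f zero) q) (seq (g zero) q) (seq (sum (f ∘ suc)) q) (seq (sum (g ∘ suc)) q))

row-affine : ∀ {p n} (i : Fin p) → Affine {p} {n} (λ X → sum (λ j → X i j))
row-affine i α X Y q = sum-comb α (X i) (Y i) (comb α X Y i) q (λ _ → refl)

column-affine : ∀ {p n} (j : Fin n) → Affine {p} {n} (λ X → sum (λ i → X i j))
column-affine j α X Y q =
  sum-comb α (λ i → X i j) (λ i → Y i j) (λ i → comb α X Y i j) q (λ _ → refl)

⟨⟩-affine : ∀ {p n} (C : Matrix p n) → Affine ⟨ C ,_⟩
⟨⟩-affine C α X Y q = sum-comb α _ _ _ q λ i → sum-comb α _ _ _ q λ j →
  solve 4 (λ c α x y → c :* (α :* x :+ (con 1ℚ :- α) :* y) := α :* (c :* x) :+ (con 1ℚ :- α) :* (c :* y))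
    refl (seq (C i j) q) α (seq (X i j) q) (seq (Y i j) q)

affine-≈ : ∀ {p n} (L : Matrix p n → ℝ) → Affine L → ∀ α X Y b →
  L X ≈ b → L Y ≈ b → L (comb α X Y) ≈ b
affine-≈ L aff α X Y b = ≈-affine α (L X) (L Y) (L (comb α X Y)) b (aff α X Y)

-- Finiteness of the index set lets double negation pass through the product: classical choices can
-- be made at all indices at once before proving a negation.
¬¬-Π : ∀ {k} {Q : Fin k → Set} → (∀ i → ¬ ¬ Q i) → ¬ ¬ (∀ i → Q i)
¬¬-Π = Finₚ.sequence (RawMonad.rawApplicative ¬¬-Monad)

-- The individual witnesses are folded with `⊕`, which keeps every property already gained on either
-- side; `a₀` ends the fold.
simultaneously : ∀ {A : Set} {k} (_⊕_ : A → A → A) (Q : Fin k → A → Set) →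
  (∀ i a b → Q i a → Q i (a ⊕ b)) → (∀ i a b → Q i b → Q i (a ⊕ b)) →
  A → (∀ i → ∃[ a ] Q i a) → ∃[ a ] (∀ i → Q i a)
simultaneously {k = zero}  _⊕_ Q l r a₀ h = a₀ , λ ()
simultaneously {k = suc k} _⊕_ Q l r a₀ h =
  let a , qa = h zero
      b , qb = simultaneously _⊕_ (Q ∘ suc) (l ∘ suc) (r ∘ suc) a₀ (h ∘ suc)
  in a ⊕ b , λ { zero → l zero a b qa ; (suc i) → r (suc i) a b (qb i) }

sum-zero : ∀ {k} (f : Fin k → ℝ) q → (∀ l → seq (f l) q ≡ 0ℚ) → seq (sum f) q ≡ 0ℚ
sum-zero {zero}  f q e = refl
sum-zero {suc k} f q e = trans (cong₂ ℚ._+_ (e zero) (sum-zero (f ∘ suc) q (e ∘ suc))) refl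

sum-single : ∀ {k} (f : Fin k → ℝ) q j → (∀ l → l ≢ j → seq (f l) q ≡ 0ℚ) →
  seq (sum f) q ≡ seq (f j) q
sum-single f q zero e = trans
  (cong (seq (f zero) q ℚ.+_) (sum-zero (f ∘ suc) q (λ l → e (suc l) λ ())))
  (ℚₚ.+-identityʳ (seq (f zero) q))
sum-single f q (suc j) e = trans
  (cong₂ ℚ._+_ (e zero λ ()) (sum-single (f ∘ suc) q j (λ l l≢j → e (suc l) (l≢j ∘ Finₚ.suc-injective))))
  (ℚₚ.+-identityˡ (seq (f (suc j)) q))

-- Faces are given by upper bounds, so nonnegativity of an entry is expressed through the negative
-- of that entry.
-unit : ∀ {p n} → Fin p → Fin n → Matrix p n
-unit i j k l = fromℚ (if does ((k Finₚ.≟ i) ×-dec (l Finₚ.≟ j)) then ℚ.- 1ℚ else 0ℚ)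

⟨-unit⟩ : ∀ {p n} (i : Fin p) (j : Fin n) (X : Matrix p n) q → seq ⟨ -unit i j , X ⟩ q ≡ ℚ.- seq (X i j) q
⟨-unit⟩ i j X q = trans
  (sum-single (λ k → sum λ l → -unit i j k l * X k l) q i λ k k≢i →
    sum-zero (λ l → -unit i j k l * X k l) q λ l → off k l (k≢i ∘ proj₁))
  (trans (sum-single (λ l → -unit i j i l * X i l) q j λ l l≢j → off i l (l≢j ∘ proj₂))
    (trans (cong (λ d → (if d then ℚ.- 1ℚ else 0ℚ) ℚ.* seq (X i j) q)
             (dec-true ((i Finₚ.≟ i) ×-dec (j Finₚ.≟ j)) (refl , refl)))
      (solve 1 (λ x → con (ℚ.- 1ℚ) :* x := :- x) refl (seq (X i j) q))))
  where
  off : ∀ k l → ¬ (k ≡ i × l ≡ j) → seq (-unit i j k l * X k l) q ≡ 0ℚ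
  off k l ne = trans (cong (λ d → (if d then ℚ.- 1ℚ else 0ℚ) ℚ.* seq (X k l) q)
      (dec-false ((k Finₚ.≟ i) ×-dec (l Finₚ.≟ j)) ne))
    (ℚₚ.*-zeroˡ (seq (X k l) q))

-- A Cauchy sequence is eventually bounded, say by `K`, and `t = η / K` gives `t z ≤ η ≤ x`.
dominates : ∀ (x z : ℝ) η → 0ℚ ℚ.< η → Lim≥0 (λ q → seq x q ℚ.- η) →
  ∃[ t ] (0ℚ ℚ.< t × Lim≥0 (λ q → seq x q ℚ.- t ℚ.* seq z q))
dominates x z η 0<η h =
 let K , 0<K , N , bound = eventually-bounded {seq z} (cauchy z)
     r , 0<r , rK≡1 = positive-inverse 0<K
     K-z : Lim≥0 (λ q → K ℚ.- seq z q)
     K-z = lim≥0 λ ε 0<ε → N , λ q p → ℚₚ.+-mono-≤-<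
       (subst (ℚ._≤ K ℚ.- seq z q) (ℚₚ.+-inverseʳ (seq z q))
       (ℚₚ.+-monoˡ-≤ (ℚ.- seq z q) (ℚₚ.≤-trans (p≤∣p∣ (seq z q)) (bound q p)))) 0<ε
 in η ℚ.* r , *-positive 0<η 0<r , Lim≥0-resp
  (λ q → trans (solve 5 (λ x e r k z → (x :- e) :+ (e :* r) :* (k :- z)
                    := x :- e :* r :* z :+ e :* (r :* k :- con 1ℚ))
                  refl (seq x q) η r K (seq z q))
    (trans (cong (λ u → seq x q ℚ.- η ℚ.* r ℚ.* seq z q ℚ.+ η ℚ.* (u ℚ.- 1ℚ)) rK≡1)
      (solve 2 (λ y e → y :+ e :* (con 1ℚ :- con 1ℚ) := y) refl (seq x q ℚ.- η ℚ.* r ℚ.* seq z q) η)))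
  (Lim≥0-+ h (Lim≥0-*-pos (*-positive 0<η 0<r) K-z))

-- Faces and facets of a general transportation polytope.

module _ {p n} (a : Fin p → ℝ) (b : Fin n → ℝ) where
  private
    P : Region p n
    P = TransportationPolytope a b

  CoordinateFace : Fin p → Fin n → Region p n
  CoordinateFace i j = P ∩ λ X → X i j ≈ 0ℝ

  -- The margins survive every affine combination; nonnegativity is a separate hypothesis because
  -- `α` may exceed 1.
  comb∈P : ∀ α X Y → X ∈ P → Y ∈ P → (∀ i j → 0ℝ ≤ comb α X Y i j) → comb α X Y ∈ P
  comb∈P α X Y (_ , cX , rX) (_ , cY , rY) 0≤ = 0≤
    , (λ j → affine-≈ (λ X → sum (λ i → X i j)) (column-affine j) α X Y (b j) (cX j) (cY j))
    , (λ i → affine-≈ (λ X → sum (λ j → X i j)) (row-affine i) α X Y (a i) (rX i) (rY i))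

  entry-Lim≥0 : ∀ X → X ∈ P → ∀ i j → Lim≥0 (seq (X i j))
  entry-Lim≥0 X (0≤X , _) i j = 0≤⇒Lim≥0 (X i j) (0≤X i j)

  midpoint∈P : ∀ X Y → X ∈ P → Y ∈ P → comb ½ X Y ∈ P
  midpoint∈P X Y X∈P Y∈P = comb∈P ½ X Y X∈P Y∈P λ i j → Lim≥0⇒0≤ (comb ½ X Y i j)
    (Lim≥0-+ (Lim≥0-*-pos (ℚₚ.positive⁻¹ ½) (entry-Lim≥0 X X∈P i j))
             (Lim≥0-*-pos (ℚₚ.positive⁻¹ ½) (entry-Lim≥0 Y Y∈P i j)))

  -- From a point Y of G that dominates t · Z one can step from Y away from Z
  -- and stay in P; a linear functional maximal at Y is then maximal at Z.
  interior⇒⊆ : ∀ G → IsFace P G → ∀ Y Z t → Y ∈ G → Z ∈ P → 0ℚ ℚ.< t →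
    (∀ i j → Lim≥0 (λ q → seq (Y i j) q ℚ.- t ℚ.* seq (Z i j) q)) → Z ∈ G
  interior⇒⊆ G (C , δ , valid , G⊆ , ⊆G) Y Z t Y∈G Z∈P 0<t dom =
    ⊆G (Z∈P , ≤-antisym ⟨ C , Z ⟩ δ (valid Z Z∈P) δ≤CZ)
    where
    Y∈P = proj₁ (G⊆ Y∈G)
    CY≈δ = proj₂ (G⊆ Y∈G)
    -- The point `(1 + t) Y - t Z` lies beyond `Y` as seen from `Z`; it is nonnegative as the sum of
    -- `Y - t Z` and `t Y`.
    W = comb (1ℚ ℚ.+ t) Y Z
    W∈P : W ∈ P
    W∈P = comb∈P (1ℚ ℚ.+ t) Y Z Y∈P Z∈P λ i j → Lim≥0⇒0≤ (W i j) (Lim≥0-resp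
      (λ q → solve 3 (λ t y z → (y :- t :* z) :+ t :* y
          := (con 1ℚ :+ t) :* y :+ (con 1ℚ :- (con 1ℚ :+ t)) :* z)
        refl t (seq (Y i j) q) (seq (Z i j) q))
      (Lim≥0-+ (dom i j) (Lim≥0-*-pos 0<t (entry-Lim≥0 Y Y∈P i j))))
    0<1+t : 0ℚ ℚ.< 1ℚ ℚ.+ t
    0<1+t = ℚₚ.+-mono-< (ℚₚ.positive⁻¹ 1ℚ) 0<t
    -- Since `⟨ C , Y ⟩ ≈ δ`, validity at `W` reads `(1 + t) δ - t ⟨ C , Z ⟩ ≤ δ`; multiplying by
    -- the inverse `r` of `t` isolates `⟨ C , Z ⟩`.
    δ≤CZ : δ ≤ ⟨ C , Z ⟩
    δ≤CZ = let r , 0<r , rt≡1 = positive-inverse 0<t in Lim≥0⇒≤ δ ⟨ C , Z ⟩ (Lim≥0-resp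
      (λ q → trans
        (cong (λ w → r ℚ.* ((seq δ q ℚ.- w) ℚ.+ (1ℚ ℚ.+ t) ℚ.* (seq ⟨ C , Y ⟩ q ℚ.- seq δ q)))
          (⟨⟩-affine C (1ℚ ℚ.+ t) Y Z q))
        (trans (solve 5 (λ r t d y z →
            r :* ((d :- ((con 1ℚ :+ t) :* y :+ (con 1ℚ :- (con 1ℚ :+ t)) :* z))
              :+ (con 1ℚ :+ t) :* (y :- d))
            := r :* t :* (z :- d)) refl r t (seq δ q) (seq ⟨ C , Y ⟩ q) (seq ⟨ C , Z ⟩ q))
          (trans (cong (ℚ._* (seq ⟨ C , Z ⟩ q ℚ.- seq δ q)) rt≡1) (ℚₚ.*-identityˡ _))))
      (Lim≥0-*-pos 0<r (Lim≥0-+ (≤⇒Lim≥0 ⟨ C , W ⟩ δ (valid W W∈P))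
                      (Lim≥0-*-pos 0<1+t (≤⇒Lim≥0 δ ⟨ C , Y ⟩
                        (≈⇒≤ δ ⟨ C , Y ⟩ (≈-sym ⟨ C , Y ⟩ δ CY≈δ)))))))

  -- Otherwise each entry is positive at some point of `G`, and averages of these points dominate
  -- every `Z` in `P`. The conclusion is negative because finding the vanishing entry would mean
  -- deciding equality of reals; the two indices supply a point to start averaging from.
  properFace⊆coordinateFace : Fin p → Fin n → ∀ G → IsProperFace P G →
    ¬ (∀ i j → ¬ (G ⊆ CoordinateFace i j))
  properFace⊆coordinateFace i₀ j₀ G (face@(C , δ , valid , G⊆ , ⊆G) , P⊈G) none =
    ¬¬-Π (λ i → ¬¬-Π (λ j → witness i j)) λ w →
      P⊈G λ {Z} Z∈P → P⊆G w Z Z∈P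
    where
    Witness : Fin p → Fin n → Set
    Witness i j = Σ[ X ∈ Matrix p n ] (X ∈ G × ∃[ η ] (0ℚ ℚ.< η × Lim≥0 (λ q → seq (X i j) q ℚ.- η)))

    witness : ∀ i j → ¬ ¬ Witness i j
    witness i j ¬w = none i j λ {X} X∈G → proj₁ (G⊆ X∈G) ,
      not-positive⇒≈0 (X i j) (proj₁ (proj₁ (G⊆ X∈G)) i j) λ pos → ¬w (X , X∈G , pos)

    midpoint∈G : ∀ X Y → X ∈ G → Y ∈ G → comb ½ X Y ∈ G
    midpoint∈G X Y X∈G Y∈G =
      let X∈P , CX = G⊆ X∈G
          Y∈P , CY = G⊆ Y∈G
      in ⊆G (midpoint∈P X Y X∈P Y∈P , affine-≈ ⟨ C ,_⟩ (⟨⟩-affine C) ½ X Y δ CX CY)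

    State : Set
    State = Σ[ Y ∈ Matrix p n ] (Y ∈ G × ∃[ t ] (0ℚ ℚ.< t))

    -- A state pairs a point of `G` with the factor by which it dominates `Z` in some entries.
    -- Averaging halves the domination inherited from either side, hence half the minimum of the
    -- factors.
    _⊕_ : State → State → State
    (X , X∈G , s , 0<s) ⊕ (Y , Y∈G , t , 0<t) = comb ½ X Y , midpoint∈G X Y X∈G Y∈G , ½ ℚ.* (s ℚ.⊓ t)
       , half-pos (⊓-pos s t 0<s 0<t)
      where
      ⊓-pos : ∀ s t → 0ℚ ℚ.< s → 0ℚ ℚ.< t → 0ℚ ℚ.< s ℚ.⊓ t
      ⊓-pos s t 0<s 0<t with ℚₚ.⊓-sel s t
      ... | inj₁ e = subst (0ℚ ℚ.<_) (sym e) 0<s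
      ... | inj₂ e = subst (0ℚ ℚ.<_) (sym e) 0<t

    P⊆G : (∀ i j → Witness i j) → ∀ Z → Z ∈ P → Z ∈ G
    P⊆G w Z Z∈P =
      -- The inner fold treats the columns of one row, the outer one the rows.
      let (Y , Y∈G , t , 0<t) , dom =
            simultaneously _⊕_ (λ i a → ∀ j → Q i j a)
              (λ i a b h j → left i j a b (h j)) (λ i a b h j → right i j a b (h j))
              (state i₀ j₀) (λ i → simultaneously _⊕_ (Q i) (left i) (right i) (state i j₀)
                (λ j → state i j , Q-state i j))
      in interior⇒⊆ G face Y Z t Y∈G Z∈P 0<t dom
      where
      Q : Fin p → Fin n → State → Set
      Q i j (Y , _ , t , _) = Lim≥0 (λ q → seq (Y i j) q ℚ.- t ℚ.* seq (Z i j) q)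

      state : Fin p → Fin n → State
      state i j = let X , X∈G , η , 0<η , h = w i j
                      t , 0<t , _ = dominates (X i j) (Z i j) η 0<η h
                  in X , X∈G , t , 0<t

      Q-state : ∀ i j → Q i j (state i j)
      Q-state i j = let X , X∈G , η , 0<η , h = w i j
                        _ , _ , dom = dominates (X i j) (Z i j) η 0<η h
                    in dom

      0<½ : 0ℚ ℚ.< ½
      0<½ = ℚₚ.positive⁻¹ ½

      slack : ∀ {s t} → s ℚ.≤ t → 0ℚ ℚ.≤ ½ ℚ.* (t ℚ.- s)
      slack {s} {t} s≤t = subst (ℚ._≤ ½ ℚ.* (t ℚ.- s)) (ℚₚ.*-zeroʳ ½)
        (ℚₚ.*-monoˡ-≤-nonNeg ½ (subst (ℚ._≤ t ℚ.- s) (ℚₚ.+-inverseʳ s) (ℚₚ.+-monoˡ-≤ (ℚ.- s) s≤t)))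

      -- With `u` the minimum of the factors, the new difference is
      -- `½ (X - s Z) + ½ Y + ½ (s - u) Z`, a sum of nonnegative terms.
      left : ∀ i j a b → Q i j a → Q i j (a ⊕ b)
      left i j (X , X∈G , s , _) (Y , Y∈G , t , _) h = Lim≥0-resp
        (λ q → solve 5 (λ x y s u z → con ½ :* (x :- s :* z) :+ (con ½ :* y :+ con ½ :* (s :- u) :* z)
            := con ½ :* x :+ (con 1ℚ :- con ½) :* y :- con ½ :* u :* z)
          refl (seq (X i j) q) (seq (Y i j) q) s (s ℚ.⊓ t) (seq (Z i j) q))
        (Lim≥0-+ (Lim≥0-*-pos 0<½ h) (Lim≥0-+ (Lim≥0-*-pos 0<½ (entry-Lim≥0 Y (proj₁ (G⊆ Y∈G)) i j))
                                 (Lim≥0-* (slack (ℚₚ.p⊓q≤p s t)) (entry-Lim≥0 Z Z∈P i j))))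

      right : ∀ i j a b → Q i j b → Q i j (a ⊕ b)
      right i j (X , X∈G , s , _) (Y , Y∈G , t , _) h = Lim≥0-resp
        (λ q → solve 5 (λ x y t u z → con ½ :* (y :- t :* z) :+ (con ½ :* x :+ con ½ :* (t :- u) :* z)
            := con ½ :* x :+ (con 1ℚ :- con ½) :* y :- con ½ :* u :* z)
          refl (seq (X i j) q) (seq (Y i j) q) t (s ℚ.⊓ t) (seq (Z i j) q))
        (Lim≥0-+ (Lim≥0-*-pos 0<½ h) (Lim≥0-+ (Lim≥0-*-pos 0<½ (entry-Lim≥0 X (proj₁ (G⊆ X∈G)) i j))
                                 (Lim≥0-* (slack (ℚₚ.p⊓q≤q s t)) (entry-Lim≥0 Z Z∈P i j))))

  coordinateFace-isFace : ∀ i j → IsFace P (CoordinateFace i j)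
  coordinateFace-isFace i j = C , 0ℝ
    , (λ X X∈P → Lim≥0⇒≤ ⟨ C , X ⟩ 0ℝ (Lim≥0-resp (λ q → sym (neg-C X q)) (entry-Lim≥0 X X∈P i j)))
    , (λ {X} (X∈P , X≈0) → X∈P , ≤-antisym ⟨ C , X ⟩ 0ℝ
        (Lim≥0⇒≤ ⟨ C , X ⟩ 0ℝ (Lim≥0-resp (λ q → sym (neg-C X q)) (entry-Lim≥0 X X∈P i j)))
        (Lim≥0⇒≤ 0ℝ ⟨ C , X ⟩ (Lim≥0-resp (λ q → sym (trans (cong (ℚ._- 0ℚ) (⟨-unit⟩ i j X q))
                (solve 1 (λ x → :- x :- con 0ℚ := con 0ℚ :- x) refl (seq (X i j) q))))
           (≤⇒Lim≥0 (X i j) 0ℝ (≈⇒≤ (X i j) 0ℝ X≈0)))))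
    , (λ {X} (X∈P , CX≈0) → X∈P , ≤-antisym (X i j) 0ℝ
        (Lim≥0⇒≤ (X i j) 0ℝ (Lim≥0-resp (λ q → trans (cong (ℚ._- 0ℚ) (⟨-unit⟩ i j X q))
                (solve 1 (λ x → :- x :- con 0ℚ := con 0ℚ :- x) refl (seq (X i j) q)))
           (≤⇒Lim≥0 0ℝ ⟨ C , X ⟩ (≈⇒≤ 0ℝ ⟨ C , X ⟩ (≈-sym ⟨ C , X ⟩ 0ℝ CX≈0)))))
        (proj₁ X∈P i j))
    where
    C = -unit i j
    neg-C : ∀ X q → 0ℚ ℚ.- seq ⟨ C , X ⟩ q ≡ seq (X i j) q
    neg-C X q = trans (cong (ℚ._-_ 0ℚ) (⟨-unit⟩ i j X q))
      (solve 1 (λ x → con 0ℚ :- (:- x) := x) refl (seq (X i j) q))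

  -- A proper face above this one lies, up to double negation, in some coordinate face, which by
  -- separation is this one; `≈0-stable` removes the double negation.
  coordinateFace-isFacet :
    (∀ i j k l → CoordinateFace i j ⊆ CoordinateFace k l → i ≡ k × j ≡ l) →
    ∀ i j → ¬ (P ⊆ CoordinateFace i j) → IsFacet P (CoordinateFace i j)
  coordinateFace-isFacet separated i j P⊈ = (coordinateFace-isFace i j , P⊈) , λ G proper F⊆G {X} X∈G →
    let X∈P = proj₁ (proj₁ (proj₂ (proj₂ (proj₂ (proj₁ proper)))) X∈G) in
    X∈P , ≈0-stable (X i j) (proj₁ X∈P i j) λ X≉0 →
      properFace⊆coordinateFace i j G proper λ k l G⊆ → case separated i j k l (G⊆ ∘ F⊆G) of λ
        { (refl , refl) → X≉0 (proj₂ (G⊆ X∈G)) }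

  facet≐coordinateFace :
    (∀ i j → ¬ (P ⊆ CoordinateFace i j)) → Fin p → Fin n →
    ∀ F → IsFacet P F → ¬ ¬ (Σ[ i ∈ Fin p ] Σ[ j ∈ Fin n ] F ≐ CoordinateFace i j)
  facet≐coordinateFace P⊈ i₀ j₀ F (proper , maximal) ¬≐ =
    properFace⊆coordinateFace i₀ j₀ F proper λ i j F⊆ →
      ¬≐ (i , j , F⊆ , maximal (CoordinateFace i j) (coordinateFace-isFace i j , P⊈ i j) F⊆)

-- Naturals inside the reals, and sums of integral entries.

∑ : ∀ {k} → (Fin k → ℕ) → ℕ
∑ = ℕ-Sum.sum

infix 8 _/1
_/1 : ℕ → ℚ
k /1 = ℤ.+ k ℚ./ 1

-- Both sides are compared as unnormalised fractions with denominator 1, where the identity is one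
-- of integers.
/1-+ : ∀ a b → (a ℕ.+ b) /1 ≡ a /1 ℚ.+ b /1
/1-+ a b = ℚₚ.toℚᵘ-injective (begin
  ℚ.toℚᵘ ((a ℕ.+ b) /1)                   ≈⟨ ℚₚ.toℚᵘ-fromℚᵘ (ℚᵘ.mkℚᵘ (ℤ.+ (a ℕ.+ b)) 0) ⟩
  ℚᵘ.mkℚᵘ (ℤ.+ (a ℕ.+ b)) 0               ≈⟨ ℚᵘ.*≡* (cong (λ z → z ℤ.* ℤ.+ 1)
                                                (sym (cong₂ ℤ._+_ (ℤₚ.*-identityʳ (ℤ.+ a)) (ℤₚ.*-identityʳ (ℤ.+ b))))) ⟩
  ℚᵘ.mkℚᵘ (ℤ.+ a) 0 ℚᵘ.+ ℚᵘ.mkℚᵘ (ℤ.+ b) 0 ≈⟨ ℚᵘₚ.+-cong (ℚₚ.toℚᵘ-fromℚᵘ (ℚᵘ.mkℚᵘ (ℤ.+ a) 0))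
                                                            (ℚₚ.toℚᵘ-fromℚᵘ (ℚᵘ.mkℚᵘ (ℤ.+ b) 0)) ⟨
  ℚ.toℚᵘ (a /1) ℚᵘ.+ ℚ.toℚᵘ (b /1)        ≈⟨ ℚₚ.toℚᵘ-homo-+ (a /1) (b /1) ⟨
  ℚ.toℚᵘ (a /1 ℚ.+ b /1)                  ∎)
  where open ℚᵘₚ.≃-Reasoning

0≤/1 : ∀ k → 0ℚ ℚ.≤ k /1
0≤/1 k = ℚₚ.nonNegative⁻¹ (k /1) {{ℚₚ.normalize-nonNeg k 1}}

/1-cancel-≤ : ∀ a b → 0ℚ ℚ.≤ b /1 ℚ.- a /1 → a ℕ.≤ b
/1-cancel-≤ a b h = ℕₚ.≮⇒≥ λ b<a → contradiction (ℚₚ.≤-<-trans (bound b<a) (neg b<a)) (ℚₚ.<-irrefl refl)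
  where
  gap : b ℕ.< a → ℕ
  gap b<a = a ∸ suc b
  bound : (b<a : b ℕ.< a) → 0ℚ ℚ.≤ ℚ.- (suc (gap b<a) /1)
  bound b<a = subst (0ℚ ℚ.≤_)
    (trans (cong (λ a → b /1 ℚ.- a /1) (sym (trans (ℕₚ.+-suc b (gap b<a)) (ℕₚ.m+[n∸m]≡n b<a))))
      (trans (cong (λ z → b /1 ℚ.- z) (/1-+ b (suc (gap b<a))))
        (solve 2 (λ x y → x :- (x :+ y) := :- y) refl (b /1) (suc (gap b<a) /1)))) h
  neg : (b<a : b ℕ.< a) → ℚ.- (suc (gap b<a) /1) ℚ.< 0ℚ
  neg b<a = ℚₚ.neg-antimono-< (ℚₚ.positive⁻¹ (suc (gap b<a) /1) {{ℚₚ.normalize-pos (suc (gap b<a)) 1}})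

≡⇒≈ : ∀ x y → (∀ q → seq x q ≡ seq y q) → x ≈ y
≡⇒≈ x y e ε 0<ε = 0 , λ q _ → subst (λ z → ℚ.∣ z ∣ ℚ.< ε)
  (sym (trans (cong (ℚ._- seq y q) (e q)) (ℚₚ.+-inverseʳ (seq y q)))) 0<ε

fromℕ-suc≉0 : ∀ k → ¬ (fromℕ (suc k) ≈ 0ℝ)
fromℕ-suc≉0 k = positive⇒≉0 (fromℕ (suc k)) (suc k /1)
  (ℚₚ.positive⁻¹ (suc k /1) {{ℚₚ.normalize-pos (suc k) 1}})
  (Lim≥0-resp (λ _ → sym (ℚₚ.+-inverseʳ (suc k /1))) (Lim≥0-const ℚₚ.≤-refl))

sum-fromℕ : ∀ {k} (g : Fin k → ℕ) q → seq (sum (λ c → fromℕ (g c))) q ≡ ∑ g /1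
sum-fromℕ {zero}  g q = refl
sum-fromℕ {suc k} g q = trans
  (cong (g zero /1 ℚ.+_) (sum-fromℕ (g ∘ suc) q)) (sym (/1-+ (g zero) (∑ (g ∘ suc))))

sum-lower-bound : ∀ {k} (f : Fin k → ℝ) (g : Fin k → ℕ) →
  (∀ c → Lim≥0 (λ q → seq (f c) q ℚ.- g c /1)) → Lim≥0 (λ q → seq (sum f) q ℚ.- ∑ g /1)
sum-lower-bound {zero}  f g h = Lim≥0-const ℚₚ.≤-refl
sum-lower-bound {suc k} f g h = Lim≥0-resp
  (λ q → trans (solve 4 (λ a b c d → a :- b :+ (c :- d) := a :+ c :- (b :+ d)) refl
                  (seq (f zero) q) (g zero /1) (seq (sum (f ∘ suc)) q) (∑ (g ∘ suc) /1))
    (cong (λ z → seq (f zero) q ℚ.+ seq (sum (f ∘ suc)) q ℚ.- z) (sym (/1-+ (g zero) (∑ (g ∘ suc))))))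
  (Lim≥0-+ (h zero) (sum-lower-bound (f ∘ suc) (g ∘ suc) (h ∘ suc)))

∑-const : ∀ k a → ∑ {k} (λ _ → a) ≡ k ℕ.* a
∑-const zero    a = refl
∑-const (suc k) a = cong (a ℕ.+_) (∑-const k a)

-- Counting in finite subsets.

bit : ∀ {k} → Subset k → Fin k → ℕ
bit p c = if lookup p c then 1 else 0

bit-∈ : ∀ {k} {p : Subset k} {c} → c Sub.∈ p → bit p c ≡ 1
bit-∈ c∈p = cong (if_then 1 else 0) (Vecₚ.[]=⇒lookup c∈p)

bit-∉ : ∀ {k} {p : Subset k} {c} → c Sub.∉ p → bit p c ≡ 0
bit-∉ {p = p} {c} c∉p with lookup p c in eq
... | true  = contradiction (Vecₚ.lookup⇒[]= c p eq) c∉p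
... | false = refl

∑-bit : ∀ {k} (p : Subset k) → ∑ (bit p) ≡ Sub.∣ p ∣
∑-bit []            = refl
∑-bit (inside  ∷ p) = cong suc (∑-bit p)
∑-bit (outside ∷ p) = ∑-bit p

∣∪∣≤ : ∀ {k} (p q : Subset k) → Sub.∣ p ∪ q ∣ ℕ.≤ Sub.∣ p ∣ ℕ.+ Sub.∣ q ∣
∣∪∣≤ []            []            = ℕ.z≤n
∣∪∣≤ (inside  ∷ p) (inside  ∷ q) = ℕ.s≤s (ℕₚ.≤-trans (∣∪∣≤ p q) (ℕₚ.+-monoʳ-≤ Sub.∣ p ∣ (ℕₚ.n≤1+n _)))
∣∪∣≤ (inside  ∷ p) (outside ∷ q) = ℕ.s≤s (∣∪∣≤ p q)
∣∪∣≤ (outside ∷ p) (inside  ∷ q) =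
  ℕₚ.≤-trans (ℕ.s≤s (∣∪∣≤ p q)) (ℕₚ.≤-reflexive (sym (ℕₚ.+-suc Sub.∣ p ∣ Sub.∣ q ∣)))
∣∪∣≤ (outside ∷ p) (outside ∷ q) = ∣∪∣≤ p q

subset-of-size : ∀ {k} (p : Subset k) t → t ℕ.≤ Sub.∣ p ∣ → ∃[ s ] (Sub.∣ s ∣ ≡ t × s Sub.⊆ p)
subset-of-size {k} p zero _ = Sub.⊥ , Subₚ.∣⊥∣≡0 k , Subₚ.⊆-min p
subset-of-size (outside ∷ p) (suc t) h =
  let s , e , s⊆p = subset-of-size p (suc t) h in outside ∷ s , e , Subₚ.s⊆s s⊆p
subset-of-size (inside ∷ p) (suc t) (ℕ.s≤s h) =
  let s , e , s⊆p = subset-of-size p t h in inside ∷ s , cong suc e , Subₚ.s⊆s s⊆p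

-- The set is chosen inside the complement of the three elements; these may coincide, so only an
-- upper bound on the size of their union is used.
avoiding : ∀ {k} t (i j l : Fin k) → 3 ℕ.+ t ℕ.≤ k →
  ∃[ s ] (Sub.∣ s ∣ ≡ t × i Sub.∉ s × j Sub.∉ s × l Sub.∉ s)
avoiding {k} t i j l h =
  let s , e , s⊆ = subset-of-size (∁ u) t t≤
  in s , e , (λ i∈s → Subₚ.x∈∁p⇒x∉p (s⊆ i∈s) (Subₚ.x∈p∪q⁺ (inj₁ (Subₚ.x∈⁅x⁆ i))))
           , (λ j∈s → Subₚ.x∈∁p⇒x∉p (s⊆ j∈s) (Subₚ.x∈p∪q⁺ (inj₂ (Subₚ.x∈p∪q⁺ (inj₁ (Subₚ.x∈⁅x⁆ j))))))
           , (λ l∈s → Subₚ.x∈∁p⇒x∉p (s⊆ l∈s) (Subₚ.x∈p∪q⁺ (inj₂ (Subₚ.x∈p∪q⁺ (inj₂ (Subₚ.x∈⁅x⁆ l))))))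
  where
  u = ⁅ i ⁆ ∪ (⁅ j ⁆ ∪ ⁅ l ⁆)
  ∣u∣≤3 : Sub.∣ u ∣ ℕ.≤ 3
  ∣u∣≤3 = begin
    Sub.∣ u ∣                                              ≤⟨ ∣∪∣≤ ⁅ i ⁆ (⁅ j ⁆ ∪ ⁅ l ⁆) ⟩
    Sub.∣ ⁅ i ⁆ ∣ ℕ.+ Sub.∣ ⁅ j ⁆ ∪ ⁅ l ⁆ ∣                ≤⟨ ℕₚ.+-monoʳ-≤ Sub.∣ ⁅ i ⁆ ∣ (∣∪∣≤ ⁅ j ⁆ ⁅ l ⁆) ⟩
    Sub.∣ ⁅ i ⁆ ∣ ℕ.+ (Sub.∣ ⁅ j ⁆ ∣ ℕ.+ Sub.∣ ⁅ l ⁆ ∣)    ≡⟨ cong₂ ℕ._+_ (Subₚ.∣⁅x⁆∣≡1 i)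
                                                                (cong₂ ℕ._+_ (Subₚ.∣⁅x⁆∣≡1 j) (Subₚ.∣⁅x⁆∣≡1 l)) ⟩
    3                                                      ∎
    where open ℕₚ.≤-Reasoning
  t≤ : t ℕ.≤ Sub.∣ ∁ u ∣
  t≤ = begin
    t                     ≡⟨ ℕₚ.m+n∸m≡n 3 t ⟨
    3 ℕ.+ t ∸ 3           ≤⟨ ℕₚ.∸-mono h ∣u∣≤3 ⟩
    k ∸ Sub.∣ u ∣         ≡⟨ Subₚ.∣∁p∣≡n∸∣p∣ u ⟨
    Sub.∣ ∁ u ∣           ∎
    where open ℕₚ.≤-Reasoning

-- The two rows and their margins.

other : Fin 2 → Fin 2
other zero    = suc zero
other (suc _) = zero

other≢ : ∀ r → other r ≢ r
other≢ zero    ()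
other≢ (suc _) ()

≢⇒other : ∀ {r s} → s ≢ r → s ≡ other r
≢⇒other {zero}     {zero}     s≢r = contradiction refl s≢r
≢⇒other {zero}     {suc zero} s≢r = refl
≢⇒other {suc zero} {zero}     s≢r = refl
≢⇒other {suc zero} {suc zero} s≢r = contradiction refl s≢r

-- A vertex of the polytope has in row r one entry 1 and, for the remaining
-- columns, entries 0 and 2; `twos r` is the number of entries 2.
twos : ℕ → Fin 2 → ℕ
twos m zero    = m ∸ 1
twos m (suc _) = m

rowMargin-twos : ∀ m r → 3 ℕ.≤ m → rowMargins m r ≡ fromℕ (suc (2 ℕ.* twos m r))
rowMargin-twos (suc m) zero    _ = cong fromℕ (ℕₚ.+-suc m (m ℕ.+ 0))
rowMargin-twos m       (suc _) _ = cong fromℕ (ℕₚ.+-comm (2 ℕ.* m) 1)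

-- Counts the columns of a vertex: one column of ones, and every other column has its 2 in exactly
-- one row.
suc-twos+twos : ∀ m r → 3 ℕ.≤ m → suc (twos m r ℕ.+ twos m (other r)) ≡ 2 ℕ.* m
suc-twos+twos (suc m) zero       _ = cong (λ z → suc (m ℕ.+ z)) (sym (ℕₚ.+-identityʳ (suc m)))
suc-twos+twos (suc m) (suc zero) _ = trans (cong suc (ℕₚ.+-comm (suc m) m))
   (cong (λ z → suc (m ℕ.+ z)) (sym (ℕₚ.+-identityʳ (suc m))))

-- The room given by `m ≥ 3`: beside the columns with entry 2 in a row, three more columns can be
-- kept free.
3+twos≤ : ∀ m r → 3 ℕ.≤ m → 3 ℕ.+ twos m r ℕ.≤ 2 ℕ.* m
3+twos≤ m r 3≤m = ℕₚ.≤-trans (ℕₚ.+-mono-≤ 3≤m (twos≤ r))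
  (ℕₚ.≤-reflexive (cong (m ℕ.+_) (sym (ℕₚ.+-identityʳ m))))
  where
  twos≤ : ∀ r → twos m r ℕ.≤ m
  twos≤ zero    = ℕₚ.m∸n≤m m 1
  twos≤ (suc _) = ℕₚ.≤-refl

-- Subsets given by decidable predicates, cardinality and dimension.

module _ {k} {Q : Fin k → Set} (Q? : Decidable Q) where
  comprehension : Subset k
  comprehension = tabulate (does ∘ Q?)

  ∈-comprehension⁺ : ∀ {x} → Q x → x Sub.∈ comprehension
  ∈-comprehension⁺ {x} q = Vecₚ.lookup⇒[]= x comprehension
    (trans (Vecₚ.lookup∘tabulate (does ∘ Q?) x) (dec-true (Q? x) q))

  ∈-comprehension⁻ : ∀ {x} → x Sub.∈ comprehension → Q x
  ∈-comprehension⁻ {x} x∈ with Q? x in eq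
  ... | yes q = q
  ... | no  _ with () ← trans (sym (Vecₚ.[]=⇒lookup x∈))
                 (trans (Vecₚ.lookup∘tabulate (does ∘ Q?) x) (cong does eq))

p∪⁅x⁆⊆ : ∀ {k} {p q : Subset k} {x} → p Sub.⊆ q → x Sub.∈ q → p ∪ ⁅ x ⁆ Sub.⊆ q
p∪⁅x⁆⊆ {p = p} {q} {x} p⊆q x∈q y∈ with Subₚ.x∈p∪q⁻ p ⁅ x ⁆ y∈
... | inj₁ y∈p = p⊆q y∈p
... | inj₂ y∈x = subst (Sub._∈ q) (sym (Subₚ.x∈⁅y⁆⇒x≡y x y∈x)) x∈q

∣p∣<∣p∪⁅x⁆∣ : ∀ {k} {p : Subset k} {x} → x Sub.∉ p → Sub.∣ p ∣ ℕ.< Sub.∣ p ∪ ⁅ x ⁆ ∣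
∣p∣<∣p∪⁅x⁆∣ {p = p} {x} x∉p = Subₚ.p⊂q⇒∣p∣<∣q∣
  (Subₚ.p⊆p∪q ⁅ x ⁆ , x , Subₚ.x∈p∪q⁺ (inj₂ (Subₚ.x∈⁅x⁆ x)) , x∉p)

p⊆q∧∣q∣≤∣p∣⇒p≡q : ∀ {k} {p q : Subset k} → p Sub.⊆ q → Sub.∣ q ∣ ℕ.≤ Sub.∣ p ∣ → p ≡ q
p⊆q∧∣q∣≤∣p∣⇒p≡q {p = p} p⊆q ∣q∣≤∣p∣ = Subₚ.⊆-antisym p⊆q λ {x} x∈q →
  decidable-stable (x Subₚ.∈? p) λ x∉p →
    ℕₚ.<⇒≱ (Subₚ.p⊂q⇒∣p∣<∣q∣ (p⊆q , x , x∈q , x∉p)) ∣q∣≤∣p∣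

∣p∣≤1⇒≡ : ∀ {k} {p : Subset k} {x y} → Sub.∣ p ∣ ℕ.≤ 1 → x Sub.∈ p → y Sub.∈ p → y ≡ x
∣p∣≤1⇒≡ {p = p} {x} {y} ∣p∣≤1 x∈p y∈p = decidable-stable (y Finₚ.≟ x) λ y≢x →
  ℕₚ.<⇒≱ (ℕₚ.≤-trans (ℕ.s≤s (ℕₚ.≤-reflexive (sym (Subₚ.∣⁅x⁆∣≡1 x))))
    (ℕₚ.≤-trans (∣p∣<∣p∪⁅x⁆∣ (Subₚ.x≢y⇒x∉⁅y⁆ y≢x)) (Subₚ.p⊆q⇒∣p∣≤∣q∣ (p∪⁅x⁆⊆
      (λ z∈ → subst (Sub._∈ p) (sym (Subₚ.x∈⁅y⁆⇒x≡y x z∈)) x∈p) y∈p)))) ∣p∣≤1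

dim-cancel-≤ : ∀ {k} {p q : Subset k} → dim p ℤ.≤ dim q → Sub.∣ p ∣ ℕ.≤ Sub.∣ q ∣
dim-cancel-≤ {p = p} {q} h = ℤₚ.drop‿+≤+ (subst₂ ℤ._≤_ (undo p) (undo q) (ℤₚ.+-monoˡ-≤ ℤ.1ℤ h))
  where
  undo : ∀ p → dim p ℤ.+ ℤ.1ℤ ≡ ℤ.+ Sub.∣ p ∣
  undo p = trans (ℤₚ.+-assoc (ℤ.+ Sub.∣ p ∣) ℤ.-1ℤ ℤ.1ℤ) (ℤₚ.+-identityʳ (ℤ.+ Sub.∣ p ∣))

dim≤0⇒∣p∣≤1 : ∀ {k} {p : Subset k} → dim p ℤ.≤ ℤ.+ 0 → Sub.∣ p ∣ ℕ.≤ 1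
dim≤0⇒∣p∣≤1 {p = p} h with Sub.∣ p ∣ | h
... | zero        | _ = ℕ.z≤n
... | suc zero    | _ = ℕ.s≤s ℕ.z≤n
... | suc (suc _) | ℤ.+≤+ ()

pure : ∀ {N k} {Δ : SimplicialComplex N} → WeaklyDecomposable k Δ → Pure Δ
pure (simplex p _)        = p
pure (shed p _ _ _ _ _ _ _) = p

top-dimensional⇒maximal : ∀ {N} {Δ : SimplicialComplex N} {e F} →
  HasDimension Δ e → Face Δ F → dim F ≡ e → MaximalFace Δ F
top-dimensional⇒maximal {F = F} (_ , bound) F∈Δ refl = F∈Δ , λ G G∈Δ F⊆G →
  p⊆q∧∣q∣≤∣p∣⇒p≡q F⊆G (dim-cancel-≤ {p = G} {q = F} (bound G G∈Δ))

-- Vertices and facets of the `2 × 2m` polytope.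

module Polytope (m : ℕ) (3≤m : 3 ℕ.≤ m) where
  n : ℕ
  n = 2 ℕ.* m

  some-column : Fin n
  some-column = Fin.fromℕ< (ℕₚ.≤-trans (ℕ.s≤s ℕ.z≤n) (3+twos≤ m zero 3≤m))

  P : Region 2 n
  P = TransportationPolytope (rowMargins m) columnMargins

  column-sum : ∀ X → X ∈ P → ∀ r c → Lim≥0 (λ q → seq (X r c) q ℚ.+ seq (X (other r) c) q ℚ.- 2 /1)
  column-sum X (_ , cols , _) zero c = Lim≥0-resp
    (λ q → solve 3 (λ x y t → x :+ (y :+ con 0ℚ) :- t := x :+ y :- t) refl
      (seq (X zero c) q) (seq (X (suc zero) c) q) (2 /1))
    (≤⇒Lim≥0 (fromℕ 2) (sum λ i → X i c) (≈⇒≤ (fromℕ 2) (sum λ i → X i c)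
      (≈-sym (sum λ i → X i c) (fromℕ 2) (cols c))))
  column-sum X X∈P (suc zero) c = Lim≥0-resp
    (λ q → cong (ℚ._- 2 /1) (ℚₚ.+-comm (seq (X zero c) q) (seq (X (suc zero) c) q)))
    (column-sum X X∈P zero c)

  zero⇒two : ∀ X → X ∈ P → ∀ r c → X (other r) c ≈ 0ℝ → Lim≥0 (λ q → seq (X r c) q ℚ.- 2 /1)
  zero⇒two X X∈P r c X≈0 = Lim≥0-resp
    (λ q → solve 3 (λ x y t → x :+ y :- t :+ (con 0ℚ :- y) := x :- t) refl
      (seq (X r c) q) (seq (X (other r) c) q) (2 /1))
    (Lim≥0-+ (column-sum X X∈P r c) (≤⇒Lim≥0 (X (other r) c) 0ℝ (≈⇒≤ (X (other r) c) 0ℝ X≈0)))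

  column-not-zero : ∀ X → X ∈ P → ∀ r c → X r c ≈ 0ℝ → X (other r) c ≈ 0ℝ → ⊥
  column-not-zero X X∈P r c h k = positive⇒≉0 (X r c) (2 /1)
    (ℚₚ.positive⁻¹ (2 /1)) (zero⇒two X X∈P r c k) h

  -- Each zero in the opposite row forces a 2 in row `r`, whose sum is `2 * twos m r + 1`; one zero
  -- more would overshoot it.
  zeros-bound : ∀ X → X ∈ P → ∀ r (s : Subset n) →
    (∀ {c} → c Sub.∈ s → X (other r) c ≈ 0ℝ) → Sub.∣ s ∣ ℕ.≤ twos m r
  zeros-bound X X∈P@(_ , _ , rows) r s h = ℕₚ.≮⇒≥ λ twos<∣s∣ →
    ℕₚ.<⇒≱ (ℕₚ.≤-trans (ℕₚ.≤-reflexive (sym (ℕₚ.*-suc 2 (twos m r))))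
             (ℕₚ.*-monoʳ-≤ 2 twos<∣s∣)) 2∣s∣≤
    where
    g : Fin n → ℕ
    g c = 2 ℕ.* bit s c
    ∑g : ∑ g ≡ 2 ℕ.* Sub.∣ s ∣
    ∑g = trans (sym (*-distribˡ-sum 2 (bit s))) (cong (2 ℕ.*_) (∑-bit s))
    entry : ∀ c → Lim≥0 (λ q → seq (X r c) q ℚ.- g c /1)
    entry c with c Subₚ.∈? s
    ... | yes c∈s = Lim≥0-resp
      (λ q → cong (λ b → seq (X r c) q ℚ.- (2 ℕ.* b) /1) (sym (bit-∈ c∈s)))
      (zero⇒two X X∈P r c (h c∈s))
    ... | no  c∉s = Lim≥0-resp
      (λ q → trans (sym (ℚₚ.+-identityʳ (seq (X r c) q)))
        (cong (λ b → seq (X r c) q ℚ.- (2 ℕ.* b) /1) (sym (bit-∉ c∉s))))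
                      (entry-Lim≥0 (rowMargins m) columnMargins X X∈P r c)
    row≤ : sum (X r) ≤ fromℕ (suc (2 ℕ.* twos m r))
    row≤ = ≈⇒≤ (sum (X r)) (fromℕ (suc (2 ℕ.* twos m r)))
      (subst (sum (X r) ≈_) (rowMargin-twos m r 3≤m) (rows r))
    2∣s∣≤ : 2 ℕ.* Sub.∣ s ∣ ℕ.≤ suc (2 ℕ.* twos m r)
    2∣s∣≤ = subst (ℕ._≤ suc (2 ℕ.* twos m r)) ∑g
      (/1-cancel-≤ (∑ g) (suc (2 ℕ.* twos m r)) (Lim≥0-const⁻¹ (Lim≥0-resp
      (λ q → solve 3 (λ x a b → x :- a :+ (b :- x) := b :- a) refl
        (seq (sum (X r)) q) (∑ g /1) (suc (2 ℕ.* twos m r) /1))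
      (Lim≥0-+ (sum-lower-bound (X r) g entry) (≤⇒Lim≥0 (sum (X r)) (fromℕ (suc (2 ℕ.* twos m r))) row≤)))))

  entries : Fin 2 → (Fin n → ℕ) → Fin 2 → Fin n → ℕ
  entries zero    v zero    = v
  entries zero    v (suc _) = λ c → 2 ∸ v c
  entries (suc _) v zero    = λ c → 2 ∸ v c
  entries (suc _) v (suc _) = v

  entries-row : ∀ r v → entries r v r ≡ v
  entries-row zero    v = refl
  entries-row (suc _) v = refl

  entries-other : ∀ r v → entries r v (other r) ≡ λ c → 2 ∸ v c
  entries-other zero    v = refl
  entries-other (suc _) v = refl

  fromEntries : (Fin 2 → Fin n → ℕ) → Matrix 2 n
  fromEntries x i c = fromℕ (x i c)

  fromEntries∈P : ∀ r v → (∀ c → v c ℕ.≤ 2) → ∑ v ≡ suc (2 ℕ.* twos m r) →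
    fromEntries (entries r v) ∈ P
  fromEntries∈P r v v≤2 ∑v =
      (λ i c → Lim≥0⇒0≤ (fromℕ (x i c)) (Lim≥0-const (0≤/1 (x i c))))
    , (λ c → ≡⇒≈ (sum λ i → fromℕ (x i c)) (fromℕ 2) λ q →
        trans (sum-fromℕ (λ i → x i c) q) (cong _/1 (column r c)))
    , λ i → subst (sum (λ c → fromℕ (x i c)) ≈_) (sym (rowMargin-twos m i 3≤m))
        (≡⇒≈ (sum λ c → fromℕ (x i c)) (fromℕ (suc (2 ℕ.* twos m i))) λ q →
          trans (sum-fromℕ (x i) q) (cong _/1 (row i)))
    where
    x = entries r v
    column : ∀ r c → ∑ (λ i → entries r v i c) ≡ 2
    column zero       c = trans (cong (v c ℕ.+_) (ℕₚ.+-identityʳ (2 ∸ v c))) (ℕₚ.m+[n∸m]≡n (v≤2 c))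
    column (suc zero) c = trans (cong (2 ∸ v c ℕ.+_) (ℕₚ.+-identityʳ (v c))) (ℕₚ.m∸n+n≡m (v≤2 c))
    t = twos m r
    u = twos m (other r)
    -- The opposite row sum is the total `2 n` less the given one, where `n = 1 + t + u`.
    ∑2-v : ∑ (λ c → 2 ∸ v c) ≡ suc (2 ℕ.* u)
    ∑2-v = ℕₚ.+-cancelˡ-≡ (suc (2 ℕ.* t)) _ _ (begin
      suc (2 ℕ.* t) ℕ.+ ∑ (λ c → 2 ∸ v c)   ≡⟨ cong (ℕ._+ ∑ (λ c → 2 ∸ v c)) ∑v ⟨
      ∑ v ℕ.+ ∑ (λ c → 2 ∸ v c)             ≡⟨ ∑-distrib-+ v (λ c → 2 ∸ v c) ⟨
      ∑ (λ c → v c ℕ.+ (2 ∸ v c))           ≡⟨ sum-cong-≗ (λ c → ℕₚ.m+[n∸m]≡n (v≤2 c)) ⟩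
      ∑ {n} (λ _ → 2)                       ≡⟨ ∑-const n 2 ⟩
      n ℕ.* 2                               ≡⟨ cong (ℕ._* 2) (suc-twos+twos m r 3≤m) ⟨
      suc (t ℕ.+ u) ℕ.* 2                   ≡⟨ ℕₚ.*-comm (suc (t ℕ.+ u)) 2 ⟩
      2 ℕ.* suc (t ℕ.+ u)                   ≡⟨ ℕₚ.*-suc 2 (t ℕ.+ u) ⟩
      2 ℕ.+ 2 ℕ.* (t ℕ.+ u)                 ≡⟨ cong (2 ℕ.+_) (ℕₚ.*-distribˡ-+ 2 t u) ⟩
      suc (suc (2 ℕ.* t ℕ.+ 2 ℕ.* u))       ≡⟨ cong suc (ℕₚ.+-suc (2 ℕ.* t) (2 ℕ.* u)) ⟨
      suc (2 ℕ.* t) ℕ.+ suc (2 ℕ.* u)       ∎)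
      where open ≡-Reasoning
    row : ∀ i → ∑ (x i) ≡ suc (2 ℕ.* twos m i)
    row i with i Finₚ.≟ r
    ... | yes refl = trans (cong ∑ (entries-row r v)) ∑v
    ... | no  i≢r  with refl ← ≢⇒other i≢r = trans (cong ∑ (entries-other r v)) ∑2-v

  vertex : ∀ r (s : Subset n) i → Sub.∣ s ∣ ≡ twos m r → i Sub.∉ s →
    Σ[ X ∈ Matrix 2 n ] (X ∈ P
      × (∀ {c} → c Sub.∈ s → X (other r) c ≈ 0ℝ)
      × (∀ {c} → c Sub.∉ s → c ≢ i → X r c ≈ 0ℝ)
      × (∀ ρ → ¬ (X ρ i ≈ 0ℝ)))
  vertex r s i ∣s∣ i∉s = X , fromEntries∈P r v v≤2 ∑v
    , (λ {c} c∈s → vanish (other r) c (trans (cong (λ f → f c) (entries-other r v)) (cong (2 ∸_) (v-∈ c∈s))))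
    , (λ {c} c∉s c≢i → vanish r c (trans (cong (λ f → f c) (entries-row r v)) (v-∉ c∉s c≢i)))
    , one
    where
    -- Row `r` is 2 on `s`, 1 at `i` and 0 elsewhere.
    v : Fin n → ℕ
    v c = 2 ℕ.* bit s c ℕ.+ bit ⁅ i ⁆ c
    X = fromEntries (entries r v)
    v-∈ : ∀ {c} → c Sub.∈ s → v c ≡ 2
    v-∈ {c} c∈s = cong₂ (λ a b → 2 ℕ.* a ℕ.+ b) (bit-∈ c∈s)
      (bit-∉ {p = ⁅ i ⁆} (Subₚ.x≢y⇒x∉⁅y⁆ λ { refl → i∉s c∈s }))
    v-∉ : ∀ {c} → c Sub.∉ s → c ≢ i → v c ≡ 0
    v-∉ {c} c∉s c≢i = cong₂ (λ a b → 2 ℕ.* a ℕ.+ b) (bit-∉ c∉s) (bit-∉ {p = ⁅ i ⁆} (Subₚ.x≢y⇒x∉⁅y⁆ c≢i))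
    v-i : v i ≡ 1
    v-i = cong₂ (λ a b → 2 ℕ.* a ℕ.+ b) (bit-∉ i∉s) (bit-∈ (Subₚ.x∈⁅x⁆ i))
    v≤2 : ∀ c → v c ℕ.≤ 2
    v≤2 c with c Subₚ.∈? s | c Finₚ.≟ i
    ... | yes c∈s | _        = ℕₚ.≤-reflexive (v-∈ c∈s)
    ... | no  _   | yes refl = ℕₚ.≤-trans (ℕₚ.≤-reflexive v-i) (ℕₚ.n≤1+n 1)
    ... | no  c∉s | no  c≢i  = ℕₚ.≤-trans (ℕₚ.≤-reflexive (v-∉ c∉s c≢i)) ℕ.z≤n
    ∑v : ∑ v ≡ suc (2 ℕ.* twos m r)
    ∑v = begin
      ∑ v                                          ≡⟨ ∑-distrib-+ (λ c → 2 ℕ.* bit s c) (bit ⁅ i ⁆) ⟩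
      ∑ (λ c → 2 ℕ.* bit s c) ℕ.+ ∑ (bit ⁅ i ⁆)    ≡⟨ cong₂ ℕ._+_ (*-distribˡ-sum 2 (bit s)) (sym (∑-bit ⁅ i ⁆)) ⟨
      2 ℕ.* ∑ (bit s) ℕ.+ Sub.∣ ⁅ i ⁆ ∣            ≡⟨ cong₂ (λ a b → 2 ℕ.* a ℕ.+ b) (trans (∑-bit s) ∣s∣)
                                                        (Subₚ.∣⁅x⁆∣≡1 i) ⟩
      2 ℕ.* twos m r ℕ.+ 1                         ≡⟨ ℕₚ.+-comm (2 ℕ.* twos m r) 1 ⟩
      suc (2 ℕ.* twos m r)                         ∎
      where open ≡-Reasoning
    vanish : ∀ ρ c → entries r v ρ c ≡ 0 → X ρ c ≈ 0ℝ
    vanish ρ c e = ≡⇒≈ (X ρ c) 0ℝ λ _ → cong _/1 e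
    entry-i : ∀ ρ → entries r v ρ i ≡ 1
    entry-i ρ with ρ Finₚ.≟ r
    ... | yes refl = trans (cong (λ f → f i) (entries-row r v)) v-i
    ... | no  ρ≢r  with refl ← ≢⇒other ρ≢r = trans (cong (λ f → f i) (entries-other r v)) (cong (2 ∸_) v-i)
    one : ∀ ρ → ¬ (X ρ i ≈ 0ℝ)
    one ρ = subst (λ k → ¬ (fromℕ k ≈ 0ℝ)) (sym (entry-i ρ)) (fromℕ-suc≉0 0)

  fresh : ∀ i j → ∃[ c ] (c ≢ i × c ≢ j)
  fresh i j with avoiding {n} 1 i i j (ℕₚ.≤-trans
    (ℕₚ.+-monoʳ-≤ 3 (ℕₚ.≤-trans (ℕₚ.m≤n+m 1 2) 3≤m)) (3+twos≤ m (suc zero) 3≤m))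
  ... | s , ∣s∣ , i∉s , _ , j∉s with Subₚ.nonempty? s
  ... | yes (c , c∈s) = c , (λ { refl → i∉s c∈s }) , λ { refl → j∉s c∈s }
  ... | no  empty with () ← trans (sym ∣s∣) (trans (cong Sub.∣_∣ (Subₚ.Empty-unique empty)) (Subₚ.∣⊥∣≡0 n))

  Coordinate : Fin 2 → Fin n → Region 2 n
  Coordinate = CoordinateFace (rowMargins m) columnMargins

  -- With its column of ones at `i`, the point avoids both facets of column `i` while lying on the
  -- facet at `r`, `j` when `j ≢ i`.
  vertexAt : ∀ r i j → Σ[ X ∈ Matrix 2 n ] (X ∈ P × (j ≢ i → X r j ≈ 0ℝ) × (∀ ρ → ¬ (X ρ i ≈ 0ℝ)))
  vertexAt r i j =
    let s , ∣s∣ , i∉s , _ , j∉s = avoiding (twos m r) i i j (3+twos≤ m r 3≤m)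
        X , X∈P , _ , zeros , nonzero = vertex r s i ∣s∣ i∉s
    in X , X∈P , zeros j∉s , nonzero

  -- For different columns, take a vertex with zero at `i`, `j` and ones in column `l`. For opposite
  -- rows of one column, a point of the smaller face would have that whole column zero.
  separated : ∀ i j k l → Coordinate i j ⊆ Coordinate k l → i ≡ k × j ≡ l
  separated i j k l ⊆ with j Finₚ.≟ l | k Finₚ.≟ i
  ... | yes refl | yes refl = refl , refl
  ... | yes refl | no  k≢i with refl ← ≢⇒other k≢i =
    let p , p≢j , _ = fresh j j
        X , X∈P , X≈0 , _ = vertexAt i p j
        Xij≈0 = X≈0 (p≢j ∘ sym)
    in ⊥-elim (column-not-zero X X∈P i j Xij≈0 (proj₂ (⊆ (X∈P , Xij≈0))))
  ... | no  j≢l  | _ =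
    let X , X∈P , X≈0 , X≉0 = vertexAt i l j
    in contradiction (proj₂ (⊆ (X∈P , X≈0 j≢l))) (X≉0 k)

  P⊈Coordinate : ∀ i j → ¬ (P ⊆ Coordinate i j)
  P⊈Coordinate i j P⊆ = let X , X∈P , _ , X≉0 = vertexAt i j j in X≉0 i (proj₂ (P⊆ X∈P))

  -- Shedding in the polar complex, with facet labels read as matrix entries.

  module Polar {N : ℕ} (E : FacetEnumeration P N)
    (label : ∀ k → Σ[ i ∈ Fin 2 ] Σ[ j ∈ Fin n ] FacetEnumeration.facet E k ≐ Coordinate i j)
    (unlabel : ∀ i j → ∃[ k ] Coordinate i j ≐ FacetEnumeration.facet E k) where

    open FacetEnumeration E
    private
      Δ = polarBoundary E
      Column = Fin n

    row : Fin N → Fin 2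
    row k = proj₁ (label k)

    col : Fin N → Column
    col k = proj₁ (proj₂ (label k))

    facet⇒≈0 : ∀ {k X} → X ∈ facet k → X (row k) (col k) ≈ 0ℝ
    facet⇒≈0 {k} X∈ = proj₂ (proj₁ (proj₂ (proj₂ (label k))) X∈)

    ≈0⇒facet : ∀ {k X} → X ∈ P → X (row k) (col k) ≈ 0ℝ → X ∈ facet k
    ≈0⇒facet {k} X∈P X≈0 = proj₂ (proj₂ (proj₂ (label k))) (X∈P , X≈0)

    label-injective : ∀ {k l} → row k ≡ row l → col k ≡ col l → k ≡ l
    label-injective {k} {l} er ec with label k | label l
    ... | i , j , k⊆ , ⊆k | _ , _ , l⊆ , ⊆l with refl ← er | refl ← ec =
      distinct k l ((λ {X} → ⊆l {X} ∘ k⊆ {X}) , (λ {X} → ⊆k {X} ∘ l⊆ {X}))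

    -- The facet found by `unlabel` carries its own entry from `label`; `separated` shows that the
    -- two entries agree.
    label-surjective : ∀ i j → ∃[ k ] (row k ≡ i × col k ≡ j)
    label-surjective i j =
      let k , ⊆k , _ = unlabel i j
          ei , ej = separated i j (row k) (col k) (λ {X} X∈ → proj₁ (proj₂ (proj₂ (label k))) (⊆k X∈))
      in k , sym ei , sym ej

    no-column-face : ∀ {G k l} → Face Δ G → k Sub.∈ G → l Sub.∈ G →
      row l ≡ other (row k) → col l ≡ col k → ⊥
    no-column-face {k = k} {l} (X , X∈P , h) k∈G l∈G er ec = column-not-zero X X∈P (row k) (col k)
      (facet⇒≈0 (h k∈G)) (subst₂ (λ i j → X i j ≈ 0ℝ) er ec (facet⇒≈0 (h l∈G)))

    -- As long as the deletions succeed, at most one label per row is missing.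
    Gone : (Fin 2 → Maybe Column) → Fin N → Set
    Gone gone k = gone (row k) ≡ just (col k)

    -- The induced subcomplex on the labels outside `Gn`, described by its faces so that the order
    -- of deletions is forgotten.
    IsDeletion : SimplicialComplex N → (Fin N → Set) → Set
    IsDeletion Δ′ Gn = ∀ G → (Face Δ′ G → Face Δ G × (∀ {k} → k Sub.∈ G → ¬ Gn k))
                           × (Face Δ G → (∀ {k} → k Sub.∈ G → ¬ Gn k) → Face Δ′ G)

    -- Some column keeps both labels. Each is a face on its own, so a simplex would have a face
    -- containing both, making the column vanish.
    not-simplex : ∀ Δ′ gone → IsDeletion Δ′ (Gone gone) → ¬ IsSimplex Δ′
    not-simplex Δ′ gone del (S , h) = 
      let _ , c≢i , c≢j = c-fresh
          k , rk , ck = label-surjective zero c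
          l , rl , cl = label-surjective (suc zero) c
          S∈Δ , _ = proj₁ (del S) (Equivalence.from (h S) id)
      in no-column-face S∈Δ (vertex-∈ k ck) (vertex-∈ l cl)
           (trans rl (cong other (sym rk))) (trans cl (sym ck))
      where
      -- The default column stands in for a row that has lost no label.
      c-fresh = fresh (fromMaybe some-column (gone zero)) (fromMaybe some-column (gone (suc zero)))
      c = proj₁ c-fresh
      present : ∀ i → gone i ≢ just c
      present zero       e = proj₁ (proj₂ c-fresh) (sym (cong (fromMaybe some-column) e))
      present (suc zero) e = proj₂ (proj₂ c-fresh) (sym (cong (fromMaybe some-column) e))
      vertex-∈ : ∀ k → col k ≡ c → k Sub.∈ S
      vertex-∈ k ck =
        -- Placing the ones in another column allows a zero at `k`, so the singleton is a face.
        let p , p≢c , _ = fresh (col k) (col k)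
            X , X∈P , X≈0 , _ = vertexAt (row k) p (col k)
        in Equivalence.to (h ⁅ k ⁆) (proj₂ (del ⁅ k ⁆)
            (X , X∈P , λ l∈ → case Subₚ.x∈⁅y⁆⇒x≡y k l∈ of λ { refl → ≈0⇒facet {k} X∈P (X≈0 (p≢c ∘ sym)) })
            (λ l∈ → case Subₚ.x∈⁅y⁆⇒x≡y k l∈ of λ { refl g → present (row k) (trans g (cong just ck)) }))
          (Subₚ.x∈⁅x⁆ k)

    delete-vertex : ∀ {Δ′ Gn x} {τ : Subset N} → x Sub.∈ τ → (∀ {y} → y Sub.∈ τ → y ≡ x) →
      IsDeletion Δ′ Gn → IsDeletion (Δ′ − τ) (λ k → Gn k ⊎ k ≡ x)
    delete-vertex {Δ′} {Gn} {x} {τ} x∈τ single del G = to , from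
      where
      to : Face (Δ′ − τ) G → Face Δ G × (∀ {k} → k Sub.∈ G → ¬ (Gn k ⊎ k ≡ x))
      to (G∈ , τ⊈G) = proj₁ (proj₁ (del G) G∈) , λ
        { k∈G (inj₁ g)    → proj₂ (proj₁ (del G) G∈) k∈G g
        ; k∈G (inj₂ refl) → τ⊈G λ y∈τ → subst (Sub._∈ G) (sym (single y∈τ)) k∈G }
      from : Face Δ G → (∀ {k} → k Sub.∈ G → ¬ (Gn k ⊎ k ≡ x)) → Face (Δ′ − τ) G
      from G∈ avoid = proj₂ (del G) G∈ (λ k∈G → avoid k∈G ∘ inj₁) , λ τ⊆G → avoid (τ⊆G x∈τ) (inj₂ refl)

    IsDeletion-cong : ∀ {Δ′ Gn Gn′} → (∀ {k} → Gn k → Gn′ k) → (∀ {k} → Gn′ k → Gn k) →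
      IsDeletion Δ′ Gn → IsDeletion Δ′ Gn′
    IsDeletion-cong f g del G =
        (λ G∈ → let G∈Δ , avoid = proj₁ (del G) G∈ in G∈Δ , λ k∈G → avoid k∈G ∘ g)
      , (λ G∈Δ avoid → proj₂ (del G) G∈Δ λ k∈G → avoid k∈G ∘ f)

    -- Let c and j be the deleted columns of row r.  The face M puts a zero in
    -- every other column, exactly `twos m r` of them outside row r, where a
    -- further zero is therefore impossible; so M is maximal after the deletion,
    -- although M ∪ ⁅ x ⁆ was a face before it.
    second-deletion-impure : ∀ Δ′ {x j} {τ : Subset N} gone →
      x Sub.∈ τ → (∀ {y} → y Sub.∈ τ → y ≡ x) →
      Face Δ′ τ → gone (row x) ≡ just j → IsDeletion Δ′ (Gone gone) →
      ∀ {e} → HasDimension Δ′ e → HasDimension (Δ′ − τ) e → ¬ Pure (Δ′ − τ)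
    second-deletion-impure Δ′ {x} {j} {τ} gone x∈τ single τ∈ gone-j del {e}
      (_ , bound) hd@((F , F∈ , dimF) , _) pr =
      -- As a face before the deletion, `M ∪ ⁅ x ⁆` has dimension at most `e`, which purity
      -- identifies with the dimension of `M`.
      ℕₚ.<⇒≱ (∣p∣<∣p∪⁅x⁆∣ x∉M) (dim-cancel-≤ {p = M ∪ ⁅ x ⁆} {q = M}
        (subst (dim (M ∪ ⁅ x ⁆) ℤ.≤_) e≡dimM (bound (M ∪ ⁅ x ⁆) M∪x∈)))
      where
      r = row x
      c = col x
      x-present : ¬ Gone gone x
      x-present = proj₂ (proj₁ (del τ) τ∈) x∈τ
      c≢j : c ≢ j
      c≢j refl = x-present gone-j
      -- The column lost by the opposite row, if any; keeping it out of `s` ensures that `M` uses no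
      -- deleted label.
      κ = fromMaybe j (gone (other r))
      choice = avoiding (twos m r) c j κ (3+twos≤ m r 3≤m)
      s = proj₁ choice
      ∣s∣ = proj₁ (proj₂ choice)
      c∉s = proj₁ (proj₂ (proj₂ choice))
      j∉s = proj₁ (proj₂ (proj₂ (proj₂ choice)))
      κ∉s = proj₂ (proj₂ (proj₂ (proj₂ choice)))

      InM : Fin N → Set
      InM k = (row k ≡ other r × col k Sub.∈ s) ⊎ (row k ≡ r × col k Sub.∉ s × col k ≢ c × col k ≢ j)
      InM? : Decidable InM
      InM? k = ((row k Finₚ.≟ other r) ×-dec (col k Subₚ.∈? s)) ⊎-dec
               ((row k Finₚ.≟ r) ×-dec (¬? (col k Subₚ.∈? s) ×-dec
                 (¬? (col k Finₚ.≟ c) ×-dec ¬? (col k Finₚ.≟ j))))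
      M = comprehension InM?

      x∉M : x Sub.∉ M
      x∉M x∈M with ∈-comprehension⁻ InM? x∈M
      ... | inj₁ (r≡ , _)          = other≢ r (sym r≡)
      ... | inj₂ (_ , _ , c≢c , _) = c≢c refl

      M∪x∈Δ : Face Δ (M ∪ ⁅ x ⁆)
      M∪x∈Δ =
        -- With the ones in column `j`, row `r` vanishes at `c`, so one point lies on the facets of
        -- `M` and of `x`.
        let X , X∈P , two , zer , _ = vertex r s j ∣s∣ j∉s
            in-M : ∀ {k} → InM k → X (row k) (col k) ≈ 0ℝ
            in-M {k} = λ
              { (inj₁ (rk , ck∈s))           → subst (λ i → X i (col k) ≈ 0ℝ) (sym rk) (two ck∈s)
              ; (inj₂ (rk , ck∉s , _ , c≢j)) → subst (λ i → X i (col k) ≈ 0ℝ) (sym rk) (zer ck∉s c≢j) }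
        in X , X∈P , λ {k} k∈ → case Subₚ.x∈p∪q⁻ M ⁅ x ⁆ k∈ of λ
          { (inj₁ k∈M) → ≈0⇒facet {k} X∈P (in-M (∈-comprehension⁻ InM? k∈M))
          ; (inj₂ k∈x) → case Subₚ.x∈⁅y⁆⇒x≡y x k∈x of λ { refl → ≈0⇒facet {k} X∈P (zer c∉s c≢j) } }

      M-present : ∀ {k} → InM k → ¬ Gone gone k
      M-present (inj₁ (rk , ck∈s)) g = κ∉s (subst (Sub._∈ s)
        (sym (cong (fromMaybe j) (trans (cong gone (sym rk)) g))) ck∈s)
      M-present (inj₂ (rk , _ , _ , ck≢j)) g
        with refl ← trans (sym g) (trans (cong gone rk) gone-j) = ck≢j refl

      M∪x∈ : Face Δ′ (M ∪ ⁅ x ⁆)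
      M∪x∈ = proj₂ (del (M ∪ ⁅ x ⁆)) M∪x∈Δ λ k∈ → case Subₚ.x∈p∪q⁻ M ⁅ x ⁆ k∈ of λ
        { (inj₁ k∈M) → M-present (∈-comprehension⁻ InM? k∈M)
        ; (inj₂ k∈x) → case Subₚ.x∈⁅y⁆⇒x≡y x k∈x of λ { refl → x-present } }

      M∈ : Face (Δ′ − τ) M
      M∈ = downClosed Δ′ M∪x∈ (Subₚ.p⊆p∪q ⁅ x ⁆) , λ τ⊆M → x∉M (τ⊆M x∈τ)

      M-absorbs : ∀ {G} → Face (Δ′ − τ) G → M Sub.⊆ G → ∀ {k} → k Sub.∈ G → InM k
      M-absorbs {G} (G∈Δ′ , τ⊈G) M⊆G {k} k∈G with row k Finₚ.≟ r
      ... | yes rk = inj₂ (rk , ck∉s , ck≢c , ck≢j)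
        where
        ck∉s : col k Sub.∉ s
        -- `M` already contains the opposite label of every column in `s`, and no face contains
        -- both.
        ck∉s ck∈s =
          let l , rl , cl = label-surjective (other r) (col k)
          in no-column-face (proj₁ (proj₁ (del G) G∈Δ′)) k∈G
               (M⊆G (∈-comprehension⁺ InM? (inj₁ (rl , subst (Sub._∈ s) (sym cl) ck∈s))))
               (trans rl (cong other (sym rk))) cl
        ck≢c : col k ≢ c
        ck≢c ck≡c = τ⊈G λ y∈τ → subst (Sub._∈ G) (trans (label-injective rk ck≡c) (sym (single y∈τ))) k∈G
        ck≢j : col k ≢ j
        ck≢j refl = proj₂ (proj₁ (del G) G∈Δ′) k∈G (trans (cong gone rk) gone-j)
      ... | no rk≢r = inj₁ (≢⇒other rk≢r , decidable-stable (col k Subₚ.∈? s) too-many)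
        where
        too-many : ¬ (col k Sub.∉ s)
        too-many ck∉s =
          -- The zeros on `s` already exhaust the bound of `zeros-bound`; column `k` would add one
          -- more.
          let (X , X∈P , h) , _ = proj₁ (del G) G∈Δ′
              zero-at : ∀ {i} → i Sub.∈ s ∪ ⁅ col k ⁆ → X (other r) i ≈ 0ℝ
              zero-at {i} i∈ = case Subₚ.x∈p∪q⁻ s ⁅ col k ⁆ i∈ of λ
                { (inj₁ i∈s) →
                    let l , rl , cl = label-surjective (other r) i
                    in subst₂ (λ a b → X a b ≈ 0ℝ) rl cl (facet⇒≈0 (h (M⊆G
                         (∈-comprehension⁺ InM? (inj₁ (rl , subst (Sub._∈ s) (sym cl) i∈s))))))
                ; (inj₂ i∈k) → subst₂ (λ a b → X a b ≈ 0ℝ) (≢⇒other rk≢r)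
                    (sym (Subₚ.x∈⁅y⁆⇒x≡y (col k) i∈k)) (facet⇒≈0 (h k∈G)) }
          in ℕₚ.<⇒≱ (subst (ℕ._< Sub.∣ s ∪ ⁅ col k ⁆ ∣) ∣s∣ (∣p∣<∣p∪⁅x⁆∣ ck∉s))
               (zeros-bound X X∈P r (s ∪ ⁅ col k ⁆) zero-at)

      M-maximal : MaximalFace (Δ′ − τ) M
      M-maximal = M∈ , λ G G∈ M⊆G → Subₚ.⊆-antisym M⊆G λ k∈G →
        ∈-comprehension⁺ InM? (M-absorbs G∈ M⊆G k∈G)

      e≡dimM : e ≡ dim M
      -- `F` attains the dimension after the deletion, hence is maximal, and purity compares it with
      -- `M`.
      e≡dimM = trans (sym dimF) (pr F M (top-dimensional⇒maximal {Δ = Δ′ − τ} hd F∈ dimF) M-maximal)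

    -- Induction on the shedding sequence. A first deletion in a row is recorded in `gone`, a second
    -- contradicts purity, and a simplex is excluded at every stage.
    not-decomposable : ∀ Δ′ gone → IsDeletion Δ′ (Gone gone) → ¬ WeaklyVertexDecomposable Δ′
    not-decomposable Δ′ gone del (simplex _ s) = not-simplex Δ′ gone del s
    not-decomposable Δ′ gone del (shed _ e hd τ τ∈ dimτ hd′ wd) with Subₚ.nonempty? τ
    -- Every set contains the empty face, so deleting it leaves no face to attain the dimension.
    ... | no  empty = let (_ , (_ , τ⊈F) , _) , _ = hd′ in τ⊈F λ {y} y∈τ → contradiction (y , y∈τ) empty
    ... | yes (x , x∈τ) with gone (row x) in eq
    ...   | just j  = second-deletion-impure Δ′ gone x∈τ
          (∣p∣≤1⇒≡ (dim≤0⇒∣p∣≤1 {p = τ} dimτ) x∈τ) τ∈ eq del hd hd′ (pure wd)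
    ...   | nothing = not-decomposable (Δ′ − τ) gone′
        (IsDeletion-cong {Δ′ − τ} to from
          (delete-vertex {Δ′} x∈τ (∣p∣≤1⇒≡ (dim≤0⇒∣p∣≤1 {p = τ} dimτ) x∈τ) del)) wd
      where
      gone′ : Fin 2 → Maybe Column
      gone′ i = if does (i Finₚ.≟ row x) then just (col x) else gone i
      to : ∀ {k} → Gone gone k ⊎ k ≡ x → Gone gone′ k
      to {k} g with row k Finₚ.≟ row x
      to (inj₂ refl) | yes _  = refl
      to {k} (inj₁ g) | yes rk with () ← trans (sym eq) (trans (cong gone (sym rk)) g)
      to (inj₁ g)    | no  _  = g
      to (inj₂ refl) | no  ne = contradiction refl ne
      from : ∀ {k} → Gone gone′ k → Gone gone k ⊎ k ≡ x
      from {k} g with row k Finₚ.≟ row x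
      from {k} g | yes rk with e ← g = inj₂ (label-injective rk (just-injective (sym g)))
      from g | no _ = inj₁ g

theorem3p2 : ∀ (m : ℕ) → 3 ℕ.≤ m →
    ∀ (N : ℕ)
    (E : FacetEnumeration
    (TransportationPolytope {2} {2 ℕ.* m} (rowMargins m) columnMargins) N) →
    ¬ WeaklyVertexDecomposable (polarBoundary E)
theorem3p2 m 3≤m N E wd =
  -- The goal is a negation, so labels known only up to double negation may be assumed.
  ¬¬-Π (λ k → facet≐coordinateFace (rowMargins m) columnMargins
          P⊈Coordinate zero some-column (facet k) (isFacet k)) λ label →
  ¬¬-Π (λ i → ¬¬-Π λ j → labelled i j) λ unlabel →
  -- Initially both rows are intact, and the complex is a deletion of itself.
  Polar.not-decomposable E label unlabel (polarBoundary E) (λ _ → nothing)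
    (λ G → (λ G∈ → G∈ , λ _ ()) , λ G∈ _ → G∈) wd
  where
  open FacetEnumeration E
  open Polytope m 3≤m
  labelled : ∀ i j → ¬ ¬ (∃[ k ] Coordinate i j ≐ facet k)
  labelled i j none = complete (Coordinate i j)
    (coordinateFace-isFacet (rowMargins m) columnMargins separated i j (P⊈Coordinate i j))
    λ k ≐k → none (k , ≐k)
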